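{- Let $K$ be a finite pure $k$-dimensional simplicial complex ($k\ge 1$) on the vertex set $[n]=\{1,\dots,n\}$, with the vertices labelled so that $\deg_K(1)\ge \deg_K(2)\ge\cdots\ge\deg_K(n)$. Then $$\sum_{r\ge1}\bigl(d^{\mathrm v,\mathsf T}_r(K)\bigr)^2-\sum_r \lambda_r(K)^2 = 2\sum_{1\le i<j\le n}(N_{ij}-R_{ij}).$$ In particular, the second-moment gap on the left is twice the total number of failed elementary shifts of facets, i.e. twice the total number of triples $(i,j,\sigma)$ with $i<j$, $\sigma\in K_k$, $j\in\sigma$, $i\notin\sigma$ and $(\sigma\setminus\{j\})\cup\{i\}\notin K_k$.
   Context: A simplicial complex $K$ on a finite vertex set is a collection of subsets closed under taking subsets; a face with $m+1$ vertices has dimension $m$, and $K_j$ is the set of $j$-dimensional faces. $K$ is $k$-dimensional if $k$ is the largest dimension of a face, and pure if every face lies in a $k$-face. The $k$-faces are called facets. Choose an orientation (an ordering of the vertices, up to even permutations) of each face. The boundary matrix $B_k=([\sigma:F])_{\sigma\in K_{k-1},F\in K_k}$ has $[\sigma:F]=0$ if $\sigma\not\subset F$, and if $F=[v_0,\dots,v_k]$ and $\sigma=F\setminus\{v_i\}$ then $[\sigma:F]=(-1)^i\operatorname{sgn}(\pi)$, where $\pi$ is the permutation carrying $(v_0,\dots,\widehat{v_i},\dots,v_k)$ to the chosen ordering of $\sigma$. The up-Laplacian is $L^{\mathrm{up}}_{k-1}(K)=B_kB_k^{\mathsf T}$; its spectrum does not depend on the orientations. $\lambda_1(K)\ge\lambda_2(K)\ge\cdots>0$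 are its nonzero eigenvalues, counted with multiplicity. $\deg_K(v)=|\{\sigma\in K_k: v\in\sigma\}|$, and $d^{\mathrm v,\mathsf T}_r(K)=|\{i\in[n]:\deg_K(i)\ge r\}|$ for $r\ge1$. For $i<j$: $N_{ij}=|\{\sigma\in K_k: j\in\sigma,\ i\notin\sigma\}|$ (admissible shifts) and $R_{ij}=|\{\sigma\in K_k: j\in\sigma,\ i\notin\sigma,\ (\sigma\setminus\{j\})\cup\{i\}\in K_k\}|$ (successful shifts); $N_{ij}-R_{ij}$ counts failed shifts. -}

module Defs where

open import Algebra.Apartness.Bundles using (HeytingField)
open import Algebra.Bundles using (CommutativeRing; Semiring)
open import Algebra.Properties.Semiring.Sum using (sum)
import Algebra.Definitions.RawSemiring as RawSemiringDefs
import Data.Bool.Properties as Bool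
open import Data.Fin.Base as Fin using (Fin; zero; suc; toℕ; punchIn)
import Data.Fin.Properties as Fin
open import Data.Fin.Subset
  using (Subset; inside; outside; _∈_; _∉_; _⊆_; _∪_; ⁅_⁆; ∣_∣)
  renaming (_-_ to _∖_)
open import Data.Fin.Subset.Properties using (_∈?_)
open import Data.Integer.Base as ℤ using (ℤ; +_; -[1+_]; 0ℤ; -1ℤ)
import Data.Integer.Properties as ℤ
open import Data.List.Base
  using (List; []; _∷_; _++_; map; filter; foldr; length; lookup; removeAt;
         allFin; upTo; cartesianProduct)
import Data.List.Membership.Propositional as List
open import Data.List.Relation.Unary.All using (All)
open import Data.List.Relation.Unary.Linked using (Linked)
open import Data.List.Relation.Unary.Unique.Propositional using (Unique)
open import Data.Nat.Base as ℕ using (ℕ; zero; suc; _≤_)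
import Data.Nat.Properties as ℕ
open import Data.Product.Base using (∃-syntax; _×_; _,_)
open import Data.Sum.Base using (_⊎_)
import Data.Vec.Base as Vec
open import Data.Vec.Properties using (≡-dec)
open import Function.Bundles using (_⇔_)
open import Level using (0ℓ; _⊔_) renaming (suc to lsuc)
open import Relation.Binary.Core using (Rel)
open import Relation.Binary.Definitions using (DecidableEquality)
open import Relation.Binary.Structures using (IsStrictPartialOrder)
open import Relation.Binary.PropositionalEquality.Core using (_≡_)
open import Relation.Nullary.Decidable.Core using (yes; no; _×-dec_; ¬?)
open import Relation.Nullary.Negation.Core using (¬_)
open import Relation.Unary using (Pred; Decidable)

------------------------------------------------------------------------
-- The real numbers

module Numerals {c ℓ₁ ℓ₂} (F : HeytingField c ℓ₁ ℓ₂) where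
  open HeytingField F

  commutativeRing : CommutativeRing c ℓ₁
  commutativeRing = record { isCommutativeRing = isCommutativeRing }

  open RawSemiringDefs
    (Semiring.rawSemiring (CommutativeRing.semiring commutativeRing)) public
    using (_^_)
    renaming (_×_ to _·_)

  fromℕ : ℕ → Carrier
  fromℕ n = n · 1#

  fromℤ : ℤ → Carrier
  fromℤ (+ n)    = fromℕ n
  fromℤ -[1+ n ] = - fromℕ (suc n)

-- The library has no real numbers. They are axiomatised here as a Cauchy
-- complete Archimedean ordered (Heyting) field; classically such a field is
-- unique up to unique isomorphism, and Bishop's reals are a constructive model.

record RealNumbers c ℓ₁ ℓ₂ ℓ₃ : Set (lsuc (c ⊔ ℓ₁ ⊔ ℓ₂ ⊔ ℓ₃)) where
  field
    heytingField : HeytingField c ℓ₁ ℓ₂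

  open HeytingField heytingField public
  open Numerals heytingField public

  infix 4 _<_ _≥_

  field
    _<_                  : Rel Carrier ℓ₃
    isStrictPartialOrder : IsStrictPartialOrder _≈_ _<_
    #⇔<⊎>                : ∀ {x y} → x # y ⇔ (x < y ⊎ y < x)
    +-monoʳ-<            : ∀ {x y} z → x < y → (z + x) < (z + y)
    *-positive           : ∀ {x y} → 0# < x → 0# < y → 0# < (x * y)
    archimedean          : ∀ x → ∃[ n ] x < fromℕ n

  _≥_ : Rel Carrier ℓ₃
  x ≥ y = ¬ (x < y)

  Cauchy : (ℕ → Carrier) → Set (c ⊔ ℓ₃)
  Cauchy s = ∀ ε → 0# < ε →
    ∃[ N ] ∀ m n → N ≤ m → N ≤ n → s m - s n < ε

  _ConvergesTo_ : (ℕ → Carrier) → Carrier → Set (c ⊔ ℓ₃)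
  s ConvergesTo l = ∀ ε → 0# < ε →
    ∃[ N ] ∀ n → N ≤ n → s n - l < ε × l - s n < ε

  field
    complete : ∀ s → Cauchy s → ∃[ l ] s ConvergesTo l

------------------------------------------------------------------------
-- Matrices and determinants

Matrix : ∀ {a} → Set a → ℕ → ℕ → Set a
Matrix A m n = Fin m → Fin n → A

module Determinant {c ℓ} (R : CommutativeRing c ℓ) where
  open CommutativeRing R hiding (zero)
  open RawSemiringDefs (Semiring.rawSemiring semiring) using (_^_)

  -- Laplace expansion along the first row.
  det : ∀ {n} → Matrix Carrier n n → Carrier
  det {zero}  M = 1#
  det {suc n} M = sum semiring λ j →
    (- 1#) ^ toℕ j * (M zero j * det λ i l → M (suc i) (punchIn j l))

module _ {c ℓ₁ ℓ₂ ℓ₃} (ℝ : RealNumbers c ℓ₁ ℓ₂ ℓ₃) where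
  open RealNumbers ℝ
  open Determinant commutativeRing

  identityMatrix : ∀ n → Matrix Carrier n n
  identityMatrix n i j with i Fin.≟ j
  ... | yes _ = 1#
  ... | no  _ = 0#

  -- det (t I - M), as a polynomial function of t.
  charPoly : ∀ {n} → Matrix ℤ n n → Carrier → Carrier
  charPoly M t = det λ i j → t * identityMatrix _ i j - fromℤ (M i j)

  -- λs lists the nonzero eigenvalues of M in nonincreasing order, each repeated
  -- according to its multiplicity as a root of the characteristic polynomial;
  -- z is the multiplicity of the eigenvalue 0.
  record IsNonzeroSpectrum {n} (M : Matrix ℤ n n) (λs : List Carrier) :
                           Set (c ⊔ ℓ₁ ⊔ ℓ₃) where
    field
      nonincreasing : Linked _≥_ λs
      nonzero       : All (λ x → ¬ (x ≈ 0#)) λs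
      z             : ℕ
      factorisation : ∀ t →
        charPoly M t ≈ t ^ z * foldr (λ x p → (t - x) * p) 1# λs

  sumOfSquares : List Carrier → Carrier
  sumOfSquares = foldr (λ x s → x ^ 2 + s) 0#

------------------------------------------------------------------------
-- Simplicial complexes on the vertex set Fin n

record SimplicialComplex (n : ℕ) : Set₁ where
  field
    Face       : Pred (Subset n) 0ℓ
    face?      : Decidable Face
    downClosed : ∀ {σ τ} → σ ⊆ τ → Face τ → Face σ

open SimplicialComplex public

infix 4 _≟ˢ_

_≟ˢ_ : ∀ {n} → DecidableEquality (Subset n)
_≟ˢ_ = ≡-dec Bool._≟_

allSubsets : ∀ n → List (Subset n)
allSubsets zero    = Vec.[] ∷ []
allSubsets (suc n) =
  map (outside Vec.∷_) (allSubsets n) ++ map (inside Vec.∷_) (allSubsets n)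

module _ {n} (K : SimplicialComplex n) where

  -- σ ∈ K_{m-1}. Faces are indexed by their number m of vertices, so that the
  -- empty face (dimension -1) causes no trouble.
  FaceOfSize : ℕ → Pred (Subset n) 0ℓ
  FaceOfSize m σ = Face K σ × ∣ σ ∣ ≡ m

  faceOfSize? : ∀ m → Decidable (FaceOfSize m)
  faceOfSize? m σ = face? K σ ×-dec ∣ σ ∣ ℕ.≟ m

  facesOfSize : ℕ → List (Subset n)
  facesOfSize m = filter (faceOfSize? m) (allSubsets n)

  -- K_k
  FaceOfDim : ℕ → Pred (Subset n) 0ℓ
  FaceOfDim k = FaceOfSize (suc k)

  faceOfDim? : ∀ k → Decidable (FaceOfDim k)
  faceOfDim? k = faceOfSize? (suc k)

  facesOfDim : ℕ → List (Subset n)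
  facesOfDim k = facesOfSize (suc k)

  record HasDim (k : ℕ) : Set where
    field
      attained : ∃[ σ ] FaceOfDim k σ
      maximal  : ∀ {σ} → Face K σ → ∣ σ ∣ ≤ suc k

  PureOfDim : ℕ → Set
  PureOfDim k = HasDim k × (∀ {σ} → Face K σ → ∃[ F ] FaceOfDim k F × σ ⊆ F)

------------------------------------------------------------------------
-- Orientations, boundary matrices and up-Laplacians

position : ∀ {n} → Fin n → List (Fin n) → ℕ
position x []       = 0
position x (y ∷ ys) with x Fin.≟ y
... | yes _ = 0
... | no  _ = suc (position x ys)

inversions : List ℕ → ℕ
inversions []       = 0
inversions (x ∷ xs) = length (filter (ℕ._<? x) xs) ℕ.+ inversions xs

-- The sign of the permutation carrying xs to ys, for two duplicate-free lists
-- with the same elements: the parity of the inversions of its one-line notation.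
sgn : ∀ {n} → List (Fin n) → List (Fin n) → ℤ
sgn xs ys = -1ℤ ℤ.^ inversions (map (λ x → position x ys) xs)

-- A representative vertex ordering for every face. The values of `order` on
-- non-faces are arbitrary and never used.
record Orientation {n} (K : SimplicialComplex n) : Set where
  field
    order     : Subset n → List (Fin n)
    unique    : ∀ {σ} → Face K σ → Unique (order σ)
    enumerate : ∀ {σ} → Face K σ → ∀ x → x List.∈ order σ ⇔ x ∈ σ

module _ {n} {K : SimplicialComplex n} (o : Orientation K) where
  open Orientation o

  -- [σ:F]; at most one i satisfies F ∖ {v_i} = σ.
  incidence : Subset n → Subset n → ℤ
  incidence σ F with Fin.any? (λ i → F ∖ lookup (order F) i ≟ˢ σ)
  ... | yes (i , _) = -1ℤ ℤ.^ toℕ i ℤ.* sgn (removeAt (order F) i) (order σ)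
  ... | no  _       = 0ℤ

  -- B_k, with rows K_{k-1} (faces with k vertices) and columns K_k.
  boundaryMatrix : ∀ k →
    Matrix ℤ (length (facesOfSize K k)) (length (facesOfDim K k))
  boundaryMatrix k i j =
    incidence (lookup (facesOfSize K k) i) (lookup (facesOfDim K k) j)

  -- L^up_{k-1} = B_k B_kᵀ
  upLaplacian : ∀ k →
    Matrix ℤ (length (facesOfSize K k)) (length (facesOfSize K k))
  upLaplacian k i j = sum (CommutativeRing.semiring ℤ.+-*-commutativeRing) λ l →
    boundaryMatrix k i l ℤ.* boundaryMatrix k j l

------------------------------------------------------------------------
-- Degrees and elementary shifts

module _ {n} (K : SimplicialComplex n) (k : ℕ) where

  deg : Fin n → ℕ
  deg v = length (filter (v ∈?_) (facesOfDim K k))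

  -- d^{v,T}_r
  conjugateDegree : ℕ → ℕ
  conjugateDegree r = length (filter (λ i → r ℕ.≤? deg i) (allFin n))

  -- Σ_{r≥1} (d^{v,T}_r)². Degrees are at most |K_k|, so the terms with
  -- r > |K_k| vanish and the sum is taken over 1 ≤ r ≤ |K_k|.
  sumOfSquaredConjugateDegrees : ℕ
  sumOfSquaredConjugateDegrees =
    foldr (λ r s → conjugateDegree (suc r) ℕ.^ 2 ℕ.+ s) 0
          (upTo (length (facesOfDim K k)))

  shift : Fin n → Fin n → Subset n → Subset n
  shift i j σ = (σ ∖ j) ∪ ⁅ i ⁆

  Admissible : Fin n → Fin n → Pred (Subset n) 0ℓ
  Admissible i j σ = j ∈ σ × i ∉ σ

  admissible? : ∀ i j → Decidable (Admissible i j)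
  admissible? i j σ = j ∈? σ ×-dec ¬? (i ∈? σ)

  Successful : Fin n → Fin n → Pred (Subset n) 0ℓ
  Successful i j σ = Admissible i j σ × FaceOfDim K k (shift i j σ)

  successful? : ∀ i j → Decidable (Successful i j)
  successful? i j σ = admissible? i j σ ×-dec faceOfDim? K k (shift i j σ)

  -- N_{ij} and R_{ij}
  admissibleShifts successfulShifts : Fin n → Fin n → ℕ
  admissibleShifts i j = length (filter (admissible? i j) (facesOfDim K k))
  successfulShifts i j = length (filter (successful? i j) (facesOfDim K k))

  pairs : List (Fin n × Fin n)
  pairs = filter (λ (i , j) → i Fin.<? j) (cartesianProduct (allFin n) (allFin n))

  -- Σ_{i<j} (N_{ij} - R_{ij})
  sumOfShiftDefects : ℤ
  sumOfShiftDefects =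
    foldr (λ (i , j) s → (+ admissibleShifts i j ℤ.- + successfulShifts i j) ℤ.+ s)
          0ℤ pairs

  FailedShift : Pred (Fin n × Fin n × Subset n) 0ℓ
  FailedShift (i , j , σ) =
    i Fin.< j × FaceOfDim K k σ × Admissible i j σ × ¬ FaceOfDim K k (shift i j σ)

  failedShift? : Decidable FailedShift
  failedShift? (i , j , σ) =
    i Fin.<? j ×-dec faceOfDim? K k σ ×-dec admissible? i j σ
      ×-dec ¬? (faceOfDim? K k (shift i j σ))

  numberOfFailedShifts : ℕ
  numberOfFailedShifts = length (filter failedShift?
    (cartesianProduct (allFin n) (cartesianProduct (allFin n) (allSubsets n))))

{-# OPTIONS --safe #-}

-- Write det (t I - M) = Σ e_i t^(n-i). Laplace expansion yields e₁ and e₂ in terms of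
-- the entries of M, and e₁² - 2e₂ = tr M². The same expression in the coefficients of
-- t^z ∏ (t - λ) is Σ λ², and two monic polynomials that agree on all natural numbers
-- have the same coefficients. Hence Σ λ² = tr (B Bᵀ)² = tr (Bᵀ B)², which is the sum of
-- ⟨F, G⟩² over pairs of facets, where ⟨F, G⟩ = Σ_σ [σ:F][σ:G]. Here ⟨F, F⟩ = k + 1, while for
-- F ≠ G at most one σ contributes, and ⟨F, G⟩² = 1 exactly when G is a shift of F. So
-- Σ λ² = |K_k| (k + 1)² + Σ_{i≠j} R_ij, where |K_k| (k + 1)² = Σ_{i,j} deg (i, j) is the sum of all
-- codegrees. On the other side Σ_r (d_r)² = Σ_{i,j} min (deg i, deg j). All these double sums
-- are symmetric in i and j, their diagonals cancel, and above the diagonal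
-- deg j - deg (i, j) - R_ij = N_ij - R_ij.

module Submission where

open import Defs
open import Algebra.Apartness.Bundles using (HeytingField)
import Algebra.Apartness.Properties.HeytingCommutativeRing as HeytingProperties
open import Algebra.Bundles using (CommutativeRing; Semiring)
import Algebra.Definitions.RawSemiring as RawSemiringDefs
import Algebra.Properties.Ring as RingProperties
import Algebra.Properties.Semiring.Mult as SemiringMult
import Algebra.Properties.Semiring.Sum as SemiringSum
import Algebra.Solver.Ring.NaturalCoefficients.Default as NaturalSolver
open import Data.Bool.Base using (if_then_else_)
open import Data.Fin.Base as Fin using (Fin; zero; suc; toℕ; punchIn)
import Data.Fin.Properties as Fin
open import Data.Fin.Subset
  using (Subset; inside; outside; _∈_; _∉_; _⊆_; _∪_; ⁅_⁆; ∣_∣)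
  renaming (_-_ to _∖_)
open import Data.Fin.Subset.Properties as Subset using (_∈?_)
open import Data.Integer.Base as ℤ using (ℤ; -[1+_])
import Data.Integer.Properties as ℤ
open import Data.Integer.Tactic.RingSolver using (solve-∀)
open import Data.List.Base
  using (List; []; _∷_; _++_; map; filter; foldr; length; lookup; removeAt; allFin;
         tabulate; upTo; applyUpTo; cartesianProduct)
import Data.List.Membership.Propositional.Properties as Membership
import Data.List.Properties as List
import Data.List.Relation.Unary.Any as Any
import Data.List.Relation.Unary.Any.Properties as Any
open import Data.Nat.Base as ℕ using (ℕ; zero; suc; _≤_; z≤n; s≤s)
import Data.Nat.Properties as ℕ
open import Data.Product.Base using (_,_; proj₁; proj₂; _×_; ∃-syntax)
open import Data.Sum.Base using (_⊎_; inj₁; inj₂)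
open import Data.Vec.Base using ([]; _∷_; here; there)
import Data.Vec.Properties as Vec
open import Function.Base using (_∘_; id)
open import Function.Bundles using (Equivalence)
open import Relation.Binary.Definitions using (tri<; tri≈; tri>)
open import Relation.Binary.PropositionalEquality as ≡ using (_≡_; _≢_)
import Relation.Binary.Reasoning.Setoid as SetoidReasoning
open import Relation.Binary.Structures using (IsStrictPartialOrder)
open import Relation.Nullary.Decidable.Core using (Dec; yes; no; does; _×-dec_; ¬?)
open import Relation.Nullary.Negation.Core using (¬_; contradiction)
open import Relation.Unary using (Pred; Decidable)

-- The spectrum is given only through a factorisation of the characteristic polynomial as a function
-- on a Heyting field, and the number of listed roots is not tied in advance to the size of the
-- matrix. So there are no eigenvectors to work with, and coefficients must be compared without
-- deciding equality of reals. Natural numbers serve as test points because distinct ones are apart,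
-- which makes their differences invertible; degrees are compared in `ℕ`, where order is decidable.
-- Coefficients are stored from the leading one downwards: `e₁` and `e₂` then sit at indices 1 and 2
-- whatever the size of the matrix, and the factor `t ^ z` does not move them. Orientations
-- disappear because an incidence number is 0 or a product of powers of -1 and enters the trace only
-- through its square. For F ≠ G this rests on the fact that two distinct common subfaces would
-- determine both facets as their union. Once Σ λ² is the image of an integer trace, all remaining
-- work takes place in `ℤ`.

ℤsum : ∀ {n} → (Fin n → ℤ) → ℤ
ℤsum = SemiringSum.sum (CommutativeRing.semiring ℤ.+-*-commutativeRing)

-- Coefficients of characteristic polynomials

module CharacteristicCoefficients {c ℓ} (R : CommutativeRing c ℓ) where
  open CommutativeRing R hiding (zero)
  open Determinant R
  open SemiringSum semiring
  open RawSemiringDefs (Semiring.rawSemiring semiring) using (_^_)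
  open RingProperties ring
    using (-‿distribˡ-*; -‿distribʳ-*; -1*x≈-x; -‿involutive)
  open NaturalSolver commutativeSemiring using (solve; _:+_; _:*_; _:=_)
  open SetoidReasoning setoid

  -- horner n f t = f 0 t^n + f 1 t^(n-1) + ... + f n: the leading coefficient comes first.
  horner : ℕ → (ℕ → Carrier) → Carrier → Carrier
  horner zero    f t = f 0
  horner (suc n) f t = t * horner n f t + f (suc n)

  -- Prefixing a zero while raising the nominal degree leaves the polynomial unchanged; raising the
  -- degree alone multiplies it by `t`, provided the sequence vanishes beyond its degree. These two
  -- moves are the whole arithmetic of the encoding.
  delay : (ℕ → Carrier) → ℕ → Carrier
  delay f zero    = 0#
  delay f (suc i) = f i

  delay-cong : ∀ {f g} → (∀ i → f i ≈ g i) → ∀ i → delay f i ≈ delay g i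
  delay-cong f≈g zero    = refl
  delay-cong f≈g (suc i) = f≈g i

  horner-cong : ∀ n {f g} → (∀ i → f i ≈ g i) → ∀ t → horner n f t ≈ horner n g t
  horner-cong zero    f≈g t = f≈g 0
  horner-cong (suc n) f≈g t = +-cong (*-congˡ (horner-cong n f≈g t)) (f≈g (suc n))

  horner-0 : ∀ n t → horner n (λ _ → 0#) t ≈ 0#
  horner-0 zero    t = refl
  horner-0 (suc n) t = begin
    t * horner n (λ _ → 0#) t + 0# ≈⟨ +-identityʳ _ ⟩
    t * horner n (λ _ → 0#) t      ≈⟨ *-congˡ (horner-0 n t) ⟩
    t * 0#                         ≈⟨ zeroʳ t ⟩
    0#                             ∎

  horner-+ : ∀ n f g t → horner n (λ i → f i + g i) t ≈ horner n f t + horner n g t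
  horner-+ zero    f g t = refl
  horner-+ (suc n) f g t = begin
    t * horner n (λ i → f i + g i) t + (f (suc n) + g (suc n))
      ≈⟨ +-congʳ (*-congˡ (horner-+ n f g t)) ⟩
    t * (horner n f t + horner n g t) + (f (suc n) + g (suc n))
      ≈⟨ solve 5 (λ t x y a b → t :* (x :+ y) :+ (a :+ b) := (t :* x :+ a) :+ (t :* y :+ b)) refl _ _ _ _ _ ⟩
    horner (suc n) f t + horner (suc n) g t ∎

  horner-* : ∀ n a f t → horner n (λ i → a * f i) t ≈ a * horner n f t
  horner-* zero    a f t = refl
  horner-* (suc n) a f t = begin
    t * horner n (λ i → a * f i) t + a * f (suc n)
      ≈⟨ +-congʳ (*-congˡ (horner-* n a f t)) ⟩
    t * (a * horner n f t) + a * f (suc n)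
      ≈⟨ solve 4 (λ t a x y → t :* (a :* x) :+ a :* y := a :* (t :* x :+ y)) refl _ _ _ _ ⟩
    a * horner (suc n) f t ∎

  horner-sum : ∀ n {m} (F : Fin m → ℕ → Carrier) t →
               horner n (λ i → sum λ j → F j i) t ≈ sum λ j → horner n (F j) t
  horner-sum n {zero}  F t = horner-0 n t
  horner-sum n {suc m} F t =
    trans (horner-+ n (F zero) _ t) (+-congˡ (horner-sum n (λ j → F (suc j)) t))

  horner-delay : ∀ n f t → horner (suc n) (delay f) t ≈ horner n f t
  horner-delay zero    f t = trans (+-congʳ (zeroʳ t)) (+-identityˡ _)
  horner-delay (suc n) f t = +-congʳ (*-congˡ (horner-delay n f t))

  -- Horner's scheme at a computes the quotient by t - a together with the remainder.
  horner-divide : ∀ n f a t →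
    horner (suc n) f t ≈ (t - a) * horner n (λ i → horner i f a) t + horner (suc n) f a
  horner-divide n f a t = go n
    where
    g : ℕ → Carrier
    g i = horner i f a

    t≈ : t ≈ (t - a) + a
    t≈ = sym (trans (+-assoc t (- a) a) (trans (+-congˡ (-‿inverseˡ a)) (+-identityʳ t)))

    go : ∀ n → horner (suc n) f t ≈ (t - a) * horner n g t + g (suc n)
    go zero = begin
      t * f 0 + f 1               ≈⟨ +-congʳ (*-congʳ t≈) ⟩
      ((t - a) + a) * f 0 + f 1
        ≈⟨ solve 4 (λ d a x y → (d :+ a) :* x :+ y := d :* x :+ (a :* x :+ y)) refl (t - a) a (f 0) (f 1) ⟩
      (t - a) * f 0 + g 1 ∎
    go (suc n) = begin
      t * horner (suc n) f t + f (suc (suc n))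
        ≈⟨ +-congʳ (*-cong t≈ (go n)) ⟩
      ((t - a) + a) * ((t - a) * horner n g t + g (suc n)) + f (suc (suc n))
        ≈⟨ solve 5 (λ d a G g f → (d :+ a) :* (d :* G :+ g) :+ f :=
                                  d :* ((d :+ a) :* G :+ g) :+ (a :* g :+ f))
             refl (t - a) a (horner n g t) (g (suc n)) (f (suc (suc n))) ⟩
      (t - a) * (((t - a) + a) * horner n g t + g (suc n)) + g (suc (suc n))
        ≈⟨ +-congʳ (*-congˡ (+-congʳ (*-congʳ t≈))) ⟨
      (t - a) * horner (suc n) g t + g (suc (suc n)) ∎

  -- Sequences are infinite although `horner n` reads only the first n + 1 terms. The bound fixes
  -- the tail, so that the coefficients at 1 and 2 make sense even for matrices of size below 2.
  DegreeBound : ℕ → (ℕ → Carrier) → Set ℓ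
  DegreeBound n f = ∀ i → n ℕ.< i → f i ≈ 0#

  horner-bounded : ∀ n {f} → DegreeBound n f → ∀ t → horner (suc n) f t ≈ t * horner n f t
  horner-bounded n f≤n t = trans (+-congˡ (f≤n (suc n) ℕ.≤-refl)) (+-identityʳ _)

  -- The term with `a` keeps the sequence and raises the degree, which multiplies by `t`; the term
  -- with `b` is delayed, which does not. The same rule serves an entry of `t A + B` in a Laplace
  -- expansion and a factor `t - x` of a product over roots.
  horner-linear : ∀ n a b {f} → DegreeBound n f → ∀ t →
    horner (suc n) (λ i → a * f i + b * delay f i) t ≈ (t * a + b) * horner n f t
  horner-linear n a b {f} f≤n t = begin
    horner (suc n) (λ i → a * f i + b * delay f i) t
      ≈⟨ horner-+ (suc n) _ _ t ⟩
    horner (suc n) (λ i → a * f i) t + horner (suc n) (λ i → b * delay f i) t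
      ≈⟨ +-cong (horner-* (suc n) a _ t) (horner-* (suc n) b _ t) ⟩
    a * horner (suc n) f t + b * horner (suc n) (delay f) t
      ≈⟨ +-cong (*-congˡ (horner-bounded n f≤n t)) (*-congˡ (horner-delay n f t)) ⟩
    a * (t * horner n f t) + b * horner n f t
      ≈⟨ solve 4 (λ t a b x → a :* (t :* x) :+ b :* x := (t :* a :+ b) :* x) refl _ _ _ _ ⟩
    (t * a + b) * horner n f t ∎

  linear-bounded : ∀ {n f} a b → DegreeBound n f →
                   DegreeBound (suc n) (λ i → a * f i + b * delay f i)
  linear-bounded a b f≤n (suc i) (s≤s n<i) = begin
    a * _ + b * _   ≈⟨ +-cong (*-congˡ (f≤n (suc i) (ℕ.m<n⇒m<1+n n<i))) (*-congˡ (f≤n i n<i)) ⟩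
    a * 0# + b * 0# ≈⟨ +-cong (zeroʳ a) (zeroʳ b) ⟩
    0# + 0#         ≈⟨ +-identityˡ 0# ⟩
    0#              ∎

  horner-^ : ∀ z n {f} → DegreeBound n f → ∀ t → horner (z ℕ.+ n) f t ≈ t ^ z * horner n f t
  horner-^ zero    n f≤n t = sym (*-identityˡ _)
  horner-^ (suc z) n {f} f≤n t = begin
    horner (suc z ℕ.+ n) f t
      ≈⟨ horner-bounded (z ℕ.+ n) (λ i z+n<i → f≤n i (ℕ.≤-<-trans (ℕ.m≤n+m n z) z+n<i)) t ⟩
    t * horner (z ℕ.+ n) f t     ≈⟨ *-congˡ (horner-^ z n f≤n t) ⟩
    t * (t ^ z * horner n f t)   ≈⟨ *-assoc _ _ _ ⟨
    t ^ suc z * horner n f t     ∎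

  sum-0 : ∀ n {f : Fin n → Carrier} → (∀ i → f i ≈ 0#) → sum f ≈ 0#
  sum-0 n f≈0 = trans (sum-cong-≋ f≈0) (sum-replicate-zero n)

  -- Laplace expansion of the pencil det (t A + B)

  minor : ∀ {n} → Matrix Carrier (suc n) (suc n) → Fin (suc n) → Matrix Carrier n n
  minor M j i l = M (suc i) (punchIn j l)

  sign : ∀ {n} → Fin n → Carrier
  sign j = (- 1#) ^ toℕ j

  -- The coefficient of t^(n-i) in det (t A + B).
  pencilCoeff : ∀ {n} → Matrix Carrier n n → Matrix Carrier n n → ℕ → Carrier
  cofactor : ∀ {n} (A B : Matrix Carrier (suc n) (suc n)) → Fin (suc n) → ℕ → Carrier

  pencilCoeff {zero}  A B zero    = 1#
  pencilCoeff {zero}  A B (suc i) = 0#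
  pencilCoeff {suc n} A B i       = sum λ j → sign j * cofactor A B j i

  cofactor A B j i =
    A zero j * pencilCoeff (minor A j) (minor B j) i +
    B zero j * delay (pencilCoeff (minor A j) (minor B j)) i

  expand : ∀ {n} (A B : Matrix Carrier (suc n) (suc n)) i {g : Fin (suc n) → Carrier} →
           (∀ j → cofactor A B j i ≈ g j) → pencilCoeff A B i ≈ sum λ j → sign j * g j
  expand A B i {g} eq =
    sum-cong-≋ {x = λ j → sign j * cofactor A B j i} {λ j → sign j * g j} λ j → *-congˡ (eq j)

  pencilCoeff-0 : ∀ {n} (A B : Matrix Carrier (suc n) (suc n)) i →
                  (∀ j → cofactor A B j i ≈ 0#) → pencilCoeff A B i ≈ 0#
  pencilCoeff-0 {n} A B i eq =
    trans (expand A B i eq) (sum-0 (suc n) {λ j → sign j * 0#} λ j → zeroʳ (sign j))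

  pencilCoeff-bounded : ∀ {n} (A B : Matrix Carrier n n) → DegreeBound n (pencilCoeff A B)
  pencilCoeff-bounded {zero}  A B (suc i) _   = refl
  pencilCoeff-bounded {suc n} A B i       n<i = pencilCoeff-0 A B i λ j →
    linear-bounded (A zero j) (B zero j) (pencilCoeff-bounded (minor A j) (minor B j)) i n<i

  det-pencil : ∀ {n} (A B : Matrix Carrier n n) t →
               det (λ i j → t * A i j + B i j) ≈ horner n (pencilCoeff A B) t
  det-pencil {zero}  A B t = refl
  det-pencil {suc n} A B t = sym (begin
    horner (suc n) (pencilCoeff A B) t
      ≈⟨ horner-sum (suc n) {suc n} (λ j i → sign j * cofactor A B j i) t ⟩
    sum (λ j → horner (suc n) (λ i → sign j * cofactor A B j i) t)
      ≈⟨ sum-cong-≋ {x = λ j → horner (suc n) (λ i → sign j * cofactor A B j i) t}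
                    {y = λ j → sign j * ((t * A zero j + B zero j) * det (N j))} column ⟩
    det (λ i j → t * A i j + B i j) ∎)
    where
    N : Fin (suc n) → Matrix Carrier n n
    N j = minor (λ i j → t * A i j + B i j) j

    column : ∀ j → horner (suc n) (λ i → sign j * cofactor A B j i) t ≈
                   sign j * ((t * A zero j + B zero j) * det (N j))
    column j = begin
      horner (suc n) (λ i → sign j * cofactor A B j i) t
        ≈⟨ horner-* (suc n) (sign j) (cofactor A B j) t ⟩
      sign j * horner (suc n) (cofactor A B j) t
        ≈⟨ *-congˡ (horner-linear n (A zero j) (B zero j) (pencilCoeff-bounded (minor A j) (minor B j)) t) ⟩
      sign j * ((t * A zero j + B zero j) * horner n (pencilCoeff (minor A j) (minor B j)) t)
        ≈⟨ *-congˡ (*-congˡ (det-pencil (minor A j) (minor B j) t)) ⟨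
      sign j * ((t * A zero j + B zero j) * det (N j)) ∎

  pencilCoeff-cong : ∀ {n} {A A′ : Matrix Carrier n n} B → (∀ i j → A i j ≈ A′ i j) →
                     ∀ i → pencilCoeff A B i ≈ pencilCoeff A′ B i
  pencilCoeff-cong {zero}  B A≈A′ zero    = refl
  pencilCoeff-cong {zero}  B A≈A′ (suc i) = refl
  pencilCoeff-cong {suc n} {A} {A′} B A≈A′ i = expand A B i λ j →
    let ih = pencilCoeff-cong {A = minor A j} {A′ = minor A′ j} (minor B j)
               (λ k l → A≈A′ (suc k) (punchIn j l))
    in +-cong (*-cong (A≈A′ zero j) (ih i)) (*-congˡ (delay-cong ih i))

  -- Defined by recursion so that `minor δ zero` reduces to `δ` by computation; `identityMatrix`,
  -- which branches on a decision, does not reduce in this way.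
  δ : ∀ {n} → Matrix Carrier n n
  δ zero    zero    = 1#
  δ zero    (suc j) = 0#
  δ (suc i) zero    = 0#
  δ (suc i) (suc j) = δ i j

  0*x+b*y≈b*y : ∀ {a x b y} → a ≈ 0# → a * x + b * y ≈ b * y
  0*x+b*y≈b*y {a} {x} {b} {y} a≈0 = begin
    a * x + b * y  ≈⟨ +-congʳ (*-congʳ a≈0) ⟩
    0# * x + b * y ≈⟨ +-congʳ (zeroˡ x) ⟩
    0# + b * y     ≈⟨ +-identityˡ _ ⟩
    b * y          ∎

  0*x+b*0≈0 : ∀ {a x b y} → a ≈ 0# → y ≈ 0# → a * x + b * y ≈ 0#
  0*x+b*0≈0 {b = b} a≈0 y≈0 = trans (0*x+b*y≈b*y a≈0) (trans (*-congˡ y≈0) (zeroʳ b))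

  -- The coefficient at 0 is det A. In its expansion, column 0 contributes a zero entry, and
  -- deleting any other column leaves the zero column in place at index 0, so induction applies.
  pencilCoeff₀-zeroColumn : ∀ {n} (A B : Matrix Carrier (suc n) (suc n)) →
    (∀ i → A i zero ≈ 0#) → pencilCoeff A B 0 ≈ 0#
  pencilCoeff₀-zeroColumn {zero} A B A₀≈0 = pencilCoeff-0 A B 0 λ where
    zero → 0*x+b*0≈0 (A₀≈0 zero) refl
  pencilCoeff₀-zeroColumn {suc n} A B A₀≈0 = pencilCoeff-0 A B 0 λ where
    zero    → 0*x+b*0≈0 (A₀≈0 zero) refl
    (suc j) → trans (+-cong (*-congˡ (pencilCoeff₀-zeroColumn (minor A (suc j)) (minor B (suc j))
                                       λ i → A₀≈0 (suc i)))
                            (zeroʳ _))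
                    (trans (+-identityʳ _) (zeroʳ _))

  pencilCoeff₀-δ : ∀ {n} (B : Matrix Carrier n n) → pencilCoeff δ B 0 ≈ 1#
  pencilCoeff₀-δ {zero}  B = refl
  pencilCoeff₀-δ {suc n} B = begin
    pencilCoeff δ B 0
      ≈⟨ +-cong (trans (*-identityˡ _) (+-cong (*-identityˡ _) (zeroʳ _)))
                (sum-0 n λ j → trans (*-congˡ (0*x+b*0≈0 refl refl)) (zeroʳ (sign (suc j)))) ⟩
    (pencilCoeff δ (minor B zero) 0 + 0#) + 0#
      ≈⟨ trans (+-identityʳ _) (+-identityʳ _) ⟩
    pencilCoeff δ (minor B zero) 0 ≈⟨ pencilCoeff₀-δ (minor B zero) ⟩
    1# ∎

  -- The minor of t I + B without row 0 and column j + 1 has a single row (the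
  -- j-th) without t, and its column 0 is constant.
  pencilCoeff₁-minor-δ : ∀ {n} (j : Fin (suc n)) (C : Matrix Carrier (suc n) (suc n)) →
    pencilCoeff (minor δ (suc j)) C 1 ≈ sign j * C j zero
  pencilCoeff₁-minor-δ {n} zero C = begin
    pencilCoeff (minor δ (suc zero)) C 1
      ≈⟨ +-cong (*-congˡ (0*x+b*y≈b*y refl)) (sum-0 n (rest n C)) ⟩
    1# * (C zero zero * pencilCoeff δ (minor C zero) 0) + 0#
      ≈⟨ trans (+-identityʳ _) (*-congˡ (*-congˡ (pencilCoeff₀-δ (minor C zero)))) ⟩
    1# * (C zero zero * 1#) ≈⟨ *-congˡ (*-identityʳ _) ⟩
    1# * C zero zero        ∎
    where
    rest : ∀ n (C : Matrix Carrier (suc n) (suc n)) j →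
           sign (suc j) * cofactor (minor δ (suc zero)) C (suc j) 1 ≈ 0#
    rest (suc n) C j = trans (*-congˡ (0*x+b*0≈0 refl
      (pencilCoeff₀-zeroColumn (minor (minor δ (suc zero)) (suc j)) (minor C (suc j)) λ _ → refl)))
      (zeroʳ _)
  pencilCoeff₁-minor-δ {suc n} (suc j) C = begin
    pencilCoeff (minor δ (suc (suc j))) C 1
      -- The top row is row 1 of the identity without column j + 2, so its only `t` stands in column
      -- 1, with sign -1. In every other column the constant entry meets the leading coefficient of
      -- a minor whose column 0 is free of `t`, and that coefficient is zero.
      ≈⟨ +-cong (trans (*-congˡ (0*x+b*0≈0 refl first)) (zeroʳ _))
                (+-cong (*-congˡ (+-cong (*-identityˡ _) (*-congˡ second))) (sum-0 n rest)) ⟩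
    0# + (sign {suc (suc n)} (suc zero) * (pencilCoeff A₁ C₁ 1 + C zero (suc zero) * 0#) + 0#)
      ≈⟨ trans (+-identityˡ _) (+-identityʳ _) ⟩
    sign {suc (suc n)} (suc zero) * (pencilCoeff A₁ C₁ 1 + C zero (suc zero) * 0#)
      ≈⟨ *-cong (*-identityʳ _) (trans (+-congˡ (zeroʳ _)) (+-identityʳ _)) ⟩
    - 1# * pencilCoeff A₁ C₁ 1
      ≈⟨ *-congˡ (trans (pencilCoeff-cong C₁ A₁≈ 1) (pencilCoeff₁-minor-δ j C₁)) ⟩
    - 1# * (sign j * C (suc j) zero) ≈⟨ *-assoc _ _ _ ⟨
    sign (suc j) * C (suc j) zero ∎
    where
    A₁ C₁ : Matrix Carrier (suc n) (suc n)
    A₁ = minor (minor δ (suc (suc j))) (suc zero)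
    C₁ = minor C (suc zero)

    A₁≈ : ∀ i l → A₁ i l ≈ minor δ (suc j) i l
    A₁≈ i zero    = refl
    A₁≈ i (suc l) = refl

    first : pencilCoeff (minor (minor δ (suc (suc j))) zero) (minor C zero) 0 ≈ 0#
    first = pencilCoeff₀-zeroColumn (minor (minor δ (suc (suc j))) zero) (minor C zero) λ _ → refl

    second : pencilCoeff A₁ C₁ 0 ≈ 0#
    second = pencilCoeff₀-zeroColumn A₁ C₁ λ _ → refl

    rest : ∀ l → sign (suc (suc l)) * cofactor (minor δ (suc (suc j))) C (suc (suc l)) 1 ≈ 0#
    rest l = trans (*-congˡ (0*x+b*0≈0 refl (pencilCoeff₀-zeroColumn
      (minor (minor δ (suc (suc j))) (suc (suc l))) (minor C (suc (suc l))) λ _ → refl)))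
      (zeroʳ _)

  trace : ∀ {n} → Matrix Carrier n n → Carrier
  trace M = sum λ i → M i i

  trace² : ∀ {n} → Matrix Carrier n n → Carrier
  trace² M = sum λ i → sum λ j → M i j * M j i

  pencilCoeff₁-δ : ∀ {n} (B : Matrix Carrier n n) → pencilCoeff δ B 1 ≈ trace B
  pencilCoeff₁-δ {zero}  B = refl
  pencilCoeff₁-δ {suc n} B = begin
    pencilCoeff δ B 1
      ≈⟨ +-cong (trans (*-identityˡ _) (+-cong (*-identityˡ _) (*-congˡ (pencilCoeff₀-δ (minor B zero)))))
                (sum-0 n (rest n B)) ⟩
    (pencilCoeff δ (minor B zero) 1 + B zero zero * 1#) + 0#
      ≈⟨ trans (+-identityʳ _) (+-cong (pencilCoeff₁-δ (minor B zero)) (*-identityʳ _)) ⟩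
    trace (minor B zero) + B zero zero
      ≈⟨ +-comm _ _ ⟩
    trace B ∎
    where
    rest : ∀ n (B : Matrix Carrier (suc n) (suc n)) j → sign (suc j) * cofactor δ B (suc j) 1 ≈ 0#
    rest (suc n) B j = trans (*-congˡ (0*x+b*0≈0 refl
      (pencilCoeff₀-zeroColumn (minor δ (suc j)) (minor B (suc j)) λ _ → refl)))
      (zeroʳ _)

  -- The contribution to `e₂` of the transpositions that move index 0, up to sign.
  cross : ∀ {n} → Matrix Carrier (suc n) (suc n) → Carrier
  cross B = sum λ j → B zero (suc j) * B (suc j) zero

  sign² : ∀ {n} (j : Fin n) → sign j * sign j ≈ 1#
  sign² zero    = *-identityˡ 1#
  sign² (suc j) = begin
    (- 1# * sign j) * (- 1# * sign j)
      ≈⟨ solve 2 (λ m s → (m :* s) :* (m :* s) := (m :* m) :* (s :* s)) refl _ _ ⟩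
    (- 1# * - 1#) * (sign j * sign j)
      ≈⟨ *-cong (trans (-1*x≈-x (- 1#)) (-‿involutive 1#)) (sign² j) ⟩
    1# * 1# ≈⟨ *-identityˡ 1# ⟩
    1# ∎

  -- `e₂` is the sum of the principal 2 × 2 minors, and those through index 0 add up to
  -- `B zero zero` times the remaining trace minus `cross B`. The minus sign appears because the
  -- Laplace sign of column j + 1 and the sign from `pencilCoeff₁-minor-δ` differ by one factor -1.
  -- Keeping `cross B` on the left lets the semiring solver finish Newton's identity.
  pencilCoeff₂-δ-step : ∀ {n} (B : Matrix Carrier (suc n) (suc n)) →
    pencilCoeff δ B 2 + cross B ≈
    pencilCoeff δ (minor B zero) 2 + B zero zero * trace (minor B zero)
  pencilCoeff₂-δ-step {n} B = begin
    pencilCoeff δ B 2 + cross B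
      ≈⟨ +-assoc _ _ _ ⟩
    sign {suc n} zero * cofactor δ B zero 2 +
    ((sum λ j → sign (suc j) * cofactor δ B (suc j) 2) + cross B)
      ≈⟨ +-cong (trans (*-identityˡ _) (+-cong (*-identityˡ _) (*-congˡ (pencilCoeff₁-δ (minor B zero)))))
                (trans (sym (∑-distrib-+ {n} _ _)) (sum-0 n (rest n B))) ⟩
    (pencilCoeff δ (minor B zero) 2 + B zero zero * trace (minor B zero)) + 0#
      ≈⟨ +-identityʳ _ ⟩
    pencilCoeff δ (minor B zero) 2 + B zero zero * trace (minor B zero) ∎
    where
    rest : ∀ n (B : Matrix Carrier (suc n) (suc n)) j →
      sign (suc j) * cofactor δ B (suc j) 2 + B zero (suc j) * B (suc j) zero ≈ 0#
    rest (suc n) B j = begin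
      sign (suc j) * cofactor δ B (suc j) 2 + b * b′
        ≈⟨ +-congʳ (*-congˡ (trans (0*x+b*y≈b*y refl) (*-congˡ (pencilCoeff₁-minor-δ j (minor B (suc j)))))) ⟩
      (- 1# * sign j) * (b * (sign j * b′)) + b * b′
        ≈⟨ +-congʳ (solve 4 (λ m s b c → (m :* s) :* (b :* (s :* c)) := m :* ((s :* s) :* (b :* c)))
                            refl _ _ _ _) ⟩
      - 1# * ((sign j * sign j) * (b * b′)) + b * b′
        ≈⟨ +-congʳ (trans (-1*x≈-x _) (-‿cong (trans (*-congʳ (sign² j)) (*-identityˡ _)))) ⟩
      - (b * b′) + b * b′ ≈⟨ -‿inverseˡ _ ⟩
      0# ∎
      where
      b  = B zero (suc j)
      b′ = B (suc j) zero

  -- Newton's identity p₂ = e₁² - 2e₂, kept free of subtraction.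
  newton-matrix : ∀ {n} (B : Matrix Carrier n n) →
    trace B * trace B ≈ trace² B + (pencilCoeff δ B 2 + pencilCoeff δ B 2)
  newton-matrix {zero}  B = trans (zeroˡ _) (sym (trans (+-identityˡ _) (+-identityˡ _)))
  newton-matrix {suc n} B = begin
    (b + T) * (b + T)
      ≈⟨ solve 2 (λ b T → (b :+ T) :* (b :+ T) := (b :* b :+ T :* T) :+ (b :* T :+ b :* T)) refl b T ⟩
    (b * b + T * T) + (b * T + b * T)
      ≈⟨ +-congʳ (+-congˡ (newton-matrix (minor B zero))) ⟩
    (b * b + (Q + (e + e))) + (b * T + b * T)
      ≈⟨ solve 4 (λ b T Q e → (b :* b :+ (Q :+ (e :+ e))) :+ (b :* T :+ b :* T) :=
                  (b :* b :+ Q) :+ ((e :+ b :* T) :+ (e :+ b :* T))) refl b T Q e ⟩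
    (b * b + Q) + ((e + b * T) + (e + b * T))
      ≈⟨ +-congˡ (+-cong (pencilCoeff₂-δ-step B) (pencilCoeff₂-δ-step B)) ⟨
    (b * b + Q) + ((E + P) + (E + P))
      ≈⟨ solve 4 (λ x Q E P → (x :+ Q) :+ ((E :+ P) :+ (E :+ P)) :=
                  ((x :+ P) :+ (P :+ Q)) :+ (E :+ E)) refl (b * b) Q E P ⟩
    ((b * b + P) + (P + Q)) + (E + E)
      ≈⟨ +-congʳ (+-congˡ (trans (+-congʳ (sum-cong-≋ {n} λ _ → *-comm _ _)) (sym (∑-distrib-+ {n} _ _)))) ⟩
    trace² B + (E + E) ∎
    where
    b = B zero zero
    T = trace (minor B zero)
    Q = trace² (minor B zero)
    e = pencilCoeff δ (minor B zero) 2
    E = pencilCoeff δ B 2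
    P = cross B

  -- Signed elementary symmetric polynomials, (-1)^i e_i. The factor `1#` gives the recursion
  -- exactly the form of `horner-linear`.
  rootCoeff : List Carrier → ℕ → Carrier
  rootCoeff []       zero    = 1#
  rootCoeff []       (suc i) = 0#
  rootCoeff (x ∷ xs) i       = 1# * rootCoeff xs i + - x * delay (rootCoeff xs) i

  rootCoeff-bounded : ∀ xs → DegreeBound (length xs) (rootCoeff xs)
  rootCoeff-bounded []       (suc i) _ = refl
  rootCoeff-bounded (x ∷ xs) = linear-bounded 1# (- x) (rootCoeff-bounded xs)

  rootCoeff₀ : ∀ xs → rootCoeff xs 0 ≈ 1#
  rootCoeff₀ []       = refl
  rootCoeff₀ (x ∷ xs) = begin
    1# * rootCoeff xs 0 + - x * 0# ≈⟨ +-cong (*-identityˡ _) (zeroʳ _) ⟩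
    rootCoeff xs 0 + 0#            ≈⟨ +-identityʳ _ ⟩
    rootCoeff xs 0                 ≈⟨ rootCoeff₀ xs ⟩
    1#                             ∎

  product-roots : ∀ xs t →
    foldr (λ x p → (t - x) * p) 1# xs ≈ horner (length xs) (rootCoeff xs) t
  product-roots []       t = refl
  product-roots (x ∷ xs) t = begin
    (t - x) * foldr (λ x p → (t - x) * p) 1# xs
      ≈⟨ *-cong (+-congʳ (sym (*-identityʳ t))) (product-roots xs t) ⟩
    (t * 1# - x) * horner (length xs) (rootCoeff xs) t
      ≈⟨ horner-linear (length xs) 1# (- x) (rootCoeff-bounded xs) t ⟨
    horner (length (x ∷ xs)) (rootCoeff (x ∷ xs)) t ∎

  powerSum₂ : List Carrier → Carrier
  powerSum₂ = foldr (λ x s → x ^ 2 + s) 0#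

  -- Has the same form as `newton-matrix`, with the same expression in the coefficients at 1 and 2.
  -- Once the coefficients are identified, the two power sums can be compared by cancellation. The
  -- roots enter negated, which squaring undoes.
  newton-roots : ∀ xs →
    rootCoeff xs 1 * rootCoeff xs 1 ≈ powerSum₂ xs + (rootCoeff xs 2 + rootCoeff xs 2)
  newton-roots []       = trans (zeroˡ _) (sym (trans (+-identityˡ _) (+-identityˡ _)))
  newton-roots (x ∷ xs) = begin
    (1# * e₁ + y * rootCoeff xs 0) * (1# * e₁ + y * rootCoeff xs 0)
      ≈⟨ *-cong e₁′ e₁′ ⟩
    (e₁ + y) * (e₁ + y)
      ≈⟨ solve 2 (λ e y → (e :+ y) :* (e :+ y) := (y :* y :+ e :* e) :+ (y :* e :+ y :* e)) refl e₁ y ⟩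
    (y * y + e₁ * e₁) + (y * e₁ + y * e₁)
      ≈⟨ +-congʳ (+-cong y² (newton-roots xs)) ⟩
    (x ^ 2 + (s + (e₂ + e₂))) + (y * e₁ + y * e₁)
      ≈⟨ solve 5 (λ x s e y f → (x :+ (s :+ (e :+ e))) :+ (y :* f :+ y :* f) :=
                  (x :+ s) :+ ((e :+ y :* f) :+ (e :+ y :* f))) refl (x ^ 2) s e₂ y e₁ ⟩
    (x ^ 2 + s) + ((e₂ + y * e₁) + (e₂ + y * e₁))
      ≈⟨ +-congˡ (+-cong one one) ⟩
    powerSum₂ (x ∷ xs) + (rootCoeff (x ∷ xs) 2 + rootCoeff (x ∷ xs) 2) ∎
    where
    y  = - x
    e₁ = rootCoeff xs 1
    e₂ = rootCoeff xs 2
    s  = powerSum₂ xs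

    one : e₂ + y * e₁ ≈ 1# * e₂ + y * e₁
    one = +-congʳ (sym (*-identityˡ e₂))

    e₁′ : 1# * e₁ + y * rootCoeff xs 0 ≈ e₁ + y
    e₁′ = +-cong (*-identityˡ e₁) (trans (*-congˡ (rootCoeff₀ xs)) (*-identityʳ y))

    y² : y * y ≈ x ^ 2
    y² = begin
      - x * - x     ≈⟨ -‿distribˡ-* x (- x) ⟨
      - (x * - x)   ≈⟨ -‿cong (-‿distribʳ-* x x) ⟨
      - - (x * x)   ≈⟨ -‿involutive _ ⟩
      x * x         ≈⟨ *-congˡ (*-identityʳ x) ⟨
      x ^ 2         ∎

-- The spectrum of an integer matrix

module Spectrum {c ℓ₁ ℓ₂ ℓ₃} (ℝ : RealNumbers c ℓ₁ ℓ₂ ℓ₃) where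
  open RealNumbers ℝ hiding (zero)
  open CommutativeRing commutativeRing using (ring; semiring)
  open RingProperties ring
  open CharacteristicCoefficients commutativeRing
  open SemiringSum semiring using (sum; sum-cong-≋)
  open SemiringMult semiring using (×-homo-+; ×1-homo-*)
  open HeytingProperties (HeytingField.heytingCommutativeRing heytingField) using (1#0)
  open IsStrictPartialOrder isStrictPartialOrder using (<-respʳ-≈; <-respˡ-≈; irrefl)
    renaming (trans to <-trans)
  open SetoidReasoning setoid

  -- Polynomials that agree on the natural numbers

  0<1 : 0# < 1#
  0<1 with Equivalence.to #⇔<⊎> 1#0
  ... | inj₂ 0<1 = 0<1
  -- If `1#` were negative, then `- 1#` would be positive, and so would its square, which is `1#`.
  ... | inj₁ 1<0 = <-respʳ-≈ (trans (-1*x≈-x (- 1#)) (-‿involutive 1#)) (*-positive 0<-1 0<-1)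
    where
    0<-1 : 0# < - 1#
    0<-1 = <-respˡ-≈ (-‿inverseˡ 1#) (<-respʳ-≈ (+-identityʳ (- 1#)) (+-monoʳ-< (- 1#) 1<0))

  fromℕ-<-suc : ∀ n → fromℕ n < fromℕ (suc n)
  fromℕ-<-suc n =
    <-respˡ-≈ (+-identityʳ (fromℕ n)) (<-respʳ-≈ (+-comm (fromℕ n) 1#) (+-monoʳ-< (fromℕ n) 0<1))

  fromℕ-mono-< : ∀ {m n} → m ℕ.< n → fromℕ m < fromℕ n
  fromℕ-mono-< {m} {suc n} (s≤s m≤n) with ℕ.m≤n⇒m<n∨m≡n m≤n
  ... | inj₁ m<n    = <-trans (fromℕ-mono-< m<n) (fromℕ-<-suc n)
  ... | inj₂ ≡.refl = fromℕ-<-suc m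

  1≉0 : ¬ 1# ≈ 0#
  1≉0 1≈0 = irrefl (sym 1≈0) 0<1

  #-cancel : ∀ {x y z} → x # y → (x - y) * z ≈ 0# → z ≈ 0#
  #-cancel {x} {y} {z} x#y xy*z≈0 with #⇒invertible x#y
  ... | (w , w*xy≈1 , _) = begin
    z                 ≈⟨ *-identityˡ z ⟨
    1# * z            ≈⟨ *-congʳ w*xy≈1 ⟨
    w * (x - y) * z   ≈⟨ *-assoc w (x - y) z ⟩
    w * ((x - y) * z) ≈⟨ *-congˡ xy*z≈0 ⟩
    w * 0#            ≈⟨ zeroʳ w ⟩
    0#                ∎

  -- Induction on the degree: divide by t - m and use that j - m is invertible for j > m, so the
  -- quotient vanishes at all later naturals. The starting point `m` is a parameter because each
  -- division uses up one root.
  horner-zero : ∀ n f m → (∀ j → m ≤ j → horner n f (fromℕ j) ≈ 0#) → ∀ i → i ≤ n → f i ≈ 0#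
  horner-zero zero    f m f≈0 .0 z≤n = f≈0 m ℕ.≤-refl
  horner-zero (suc n) f m f≈0 i i≤1+n = coefficient i i≤1+n
    where
    a = fromℕ m

    g : ℕ → Carrier
    g i = horner i f a

    quotient≈0 : ∀ j → suc m ≤ j → horner n g (fromℕ j) ≈ 0#
    quotient≈0 j m<j = #-cancel (Equivalence.from #⇔<⊎> (inj₂ (fromℕ-mono-< m<j))) (begin
      (fromℕ j - a) * horner n g (fromℕ j)               ≈⟨ +-identityʳ _ ⟨
      (fromℕ j - a) * horner n g (fromℕ j) + 0#          ≈⟨ +-congˡ (f≈0 m ℕ.≤-refl) ⟨
      (fromℕ j - a) * horner n g (fromℕ j) + g (suc n)   ≈⟨ horner-divide n f a (fromℕ j) ⟨
      horner (suc n) f (fromℕ j)                         ≈⟨ f≈0 j (ℕ.<⇒≤ m<j) ⟩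
      0#                                                 ∎)

    -- The sequence `g` holds the coefficients of the quotient up to index n and the remainder at n
    -- + 1. The former vanish by induction, the latter because `a` is a root.
    g≈0 : ∀ i → i ≤ suc n → g i ≈ 0#
    g≈0 i i≤1+n with ℕ.m≤n⇒m<n∨m≡n i≤1+n
    ... | inj₁ (s≤s i≤n) = horner-zero n g (suc m) quotient≈0 i i≤n
    ... | inj₂ ≡.refl    = f≈0 m ℕ.≤-refl

    coefficient : ∀ i → i ≤ suc n → f i ≈ 0#
    coefficient zero    _    = g≈0 0 z≤n
    coefficient (suc i) i<1+n = begin
      f (suc i)               ≈⟨ +-identityˡ _ ⟨
      0# + f (suc i)          ≈⟨ +-congʳ (zeroʳ a) ⟨
      a * 0# + f (suc i)      ≈⟨ +-congʳ (*-congˡ (g≈0 i (ℕ.<⇒≤ i<1+n))) ⟨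
      g (suc i)               ≈⟨ g≈0 (suc i) i<1+n ⟩
      0#                      ∎

  horner-injective : ∀ n f g → (∀ t → horner n f t ≈ horner n g t) → ∀ i → i ≤ n → f i ≈ g i
  horner-injective n f g f≈g i i≤n = begin
    f i                       ≈⟨ +-identityʳ _ ⟨
    f i + 0#                  ≈⟨ +-congˡ (-‿inverseˡ (g i)) ⟨
    f i + (- g i + g i)       ≈⟨ +-assoc _ _ _ ⟨
    (f i + - g i) + g i       ≈⟨ +-congʳ (+-congˡ (-1*x≈-x (g i))) ⟨
    (f i + - 1# * g i) + g i
      ≈⟨ +-congʳ (horner-zero n (λ i → f i + - 1# * g i) 0 (λ j _ → vanishes (fromℕ j)) i i≤n) ⟩
    0# + g i                  ≈⟨ +-identityˡ _ ⟩
    g i                       ∎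
    where
    vanishes : ∀ t → horner n (λ i → f i + - 1# * g i) t ≈ 0#
    vanishes t = begin
      horner n (λ i → f i + - 1# * g i) t          ≈⟨ horner-+ n f (λ i → - 1# * g i) t ⟩
      horner n f t + horner n (λ i → - 1# * g i) t
        ≈⟨ +-cong (f≈g t) (trans (horner-* n (- 1#) g t) (-1*x≈-x _)) ⟩
      horner n g t - horner n g t                  ≈⟨ -‿inverseʳ _ ⟩
      0#                                           ∎

  delays : ℕ → (ℕ → Carrier) → ℕ → Carrier
  delays zero    f = f
  delays (suc k) f = delay (delays k f)

  horner-delays : ∀ k n f t → horner (k ℕ.+ n) (delays k f) t ≈ horner n f t
  horner-delays zero    n f t = refl
  horner-delays (suc k) n f t = trans (horner-delay (k ℕ.+ n) (delays k f) t) (horner-delays k n f t)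

  -- Padding `f` with n - m leading zeros presents both sides in degree n; comparing leading
  -- coefficients would give 1 = 0.
  monic-degree-≮ : ∀ m n f g → g 0 ≈ 1# → (∀ t → horner m f t ≈ horner n g t) → ¬ m ℕ.< n
  monic-degree-≮ m n f g g₀≈1 f≈g m<n with ℕ.m≤n⇒∃[o]m+o≡n m<n
  ... | (k , ≡.refl) = 1≉0 (trans (sym g₀≈1)
    (horner-injective n g (delays (suc k) f) agree 0 z≤n))
    where
    agree : ∀ t → horner n g t ≈ horner n (delays (suc k) f) t
    agree t = begin
      horner n g t                                    ≈⟨ f≈g t ⟨
      horner m f t                                    ≈⟨ horner-delays (suc k) m f t ⟨
      horner (suc k ℕ.+ m) (delays (suc k) f) t
        ≡⟨ ≡.cong (λ e → horner (suc e) (delays (suc k) f) t) (ℕ.+-comm k m) ⟩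
      horner n (delays (suc k) f) t                   ∎

  -- Applied with m the size of the matrix and n the number of listed roots including `z`. Their
  -- equality is a consequence and not an assumption, and the bounds settle the indices beyond the
  -- common degree.
  monic-unique : ∀ m n f g → f 0 ≈ 1# → g 0 ≈ 1# → DegreeBound m f → DegreeBound n g →
    (∀ t → horner m f t ≈ horner n g t) → ∀ i → f i ≈ g i
  monic-unique m n f g f₀≈1 g₀≈1 f≤m g≤n f≈g i with ℕ.<-cmp m n
  ... | tri< m<n _ _ = contradiction m<n (monic-degree-≮ m n f g g₀≈1 f≈g)
  ... | tri> _ _ n<m = contradiction n<m (monic-degree-≮ n m g f f₀≈1 (λ t → sym (f≈g t)))
  ... | tri≈ _ ≡.refl _ with i ℕ.≤? m
  ...   | yes i≤m = horner-injective m f g f≈g i i≤m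
  ...   | no  i≰m = trans (f≤m i (ℕ.≰⇒> i≰m)) (sym (g≤n i (ℕ.≰⇒> i≰m)))

  -- The ring homomorphism from ℤ to the reals

  fromℤ-neg : ∀ i → fromℤ (ℤ.- i) ≈ - fromℤ i
  fromℤ-neg (ℤ.+ zero)  = sym -0#≈0#
  fromℤ-neg (ℤ.+ suc n) = refl
  fromℤ-neg -[1+ n ]  = sym (-‿involutive _)

  fromℤ-⊖ : ∀ m n → fromℤ (m ℤ.⊖ n) ≈ fromℕ m - fromℕ n
  fromℤ-⊖ m       zero    = sym (trans (+-congˡ -0#≈0#) (+-identityʳ _))
  fromℤ-⊖ zero    (suc n) = sym (+-identityˡ _)
  fromℤ-⊖ (suc m) (suc n) = begin
    fromℤ (suc m ℤ.⊖ suc n)               ≡⟨ ≡.cong fromℤ (ℤ.[1+m]⊖[1+n]≡m⊖n m n) ⟩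
    fromℤ (m ℤ.⊖ n)                       ≈⟨ fromℤ-⊖ m n ⟩
    fromℕ m - fromℕ n                     ≈⟨ +-congʳ (+-identityˡ _) ⟨
    (0# + fromℕ m) - fromℕ n              ≈⟨ +-congʳ (+-congʳ (-‿inverseʳ 1#)) ⟨
    ((1# + - 1#) + fromℕ m) - fromℕ n
      ≈⟨ solve 4 (λ a b m n → ((a :+ b) :+ m) :+ n := (a :+ m) :+ (b :+ n))
                 refl 1# (- 1#) (fromℕ m) (- fromℕ n) ⟩
    (1# + fromℕ m) + (- 1# + - fromℕ n)   ≈⟨ +-congˡ (-‿+-comm 1# (fromℕ n)) ⟩
    fromℕ (suc m) - fromℕ (suc n)         ∎
    where
    open NaturalSolver (CommutativeRing.commutativeSemiring commutativeRing)
      using (solve; _:+_; _:=_)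

  fromℤ-+ : ∀ i j → fromℤ (i ℤ.+ j) ≈ fromℤ i + fromℤ j
  fromℤ-+ (ℤ.+ m)    (ℤ.+ n)    = ×-homo-+ 1# m n
  fromℤ-+ (ℤ.+ m)    -[1+ n ] = fromℤ-⊖ m (suc n)
  fromℤ-+ -[1+ m ] (ℤ.+ n)    = trans (fromℤ-⊖ n (suc m)) (+-comm _ _)
  fromℤ-+ -[1+ m ] -[1+ n ] = begin
    - fromℕ (suc (suc (m ℕ.+ n)))         ≡⟨ ≡.cong (λ k → - fromℕ (suc k)) (ℕ.+-suc m n) ⟨
    - fromℕ (suc m ℕ.+ suc n)             ≈⟨ -‿cong (×-homo-+ 1# (suc m) (suc n)) ⟩
    - (fromℕ (suc m) + fromℕ (suc n))     ≈⟨ -‿+-comm _ _ ⟨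
    - fromℕ (suc m) + - fromℕ (suc n)     ∎

  fromℤ-* : ∀ i j → fromℤ (i ℤ.* j) ≈ fromℤ i * fromℤ j
  fromℤ-* (ℤ.+ m) j = nonneg m j
    where
    nonneg : ∀ m j → fromℤ (ℤ.+ m ℤ.* j) ≈ fromℕ m * fromℤ j
    nonneg m (ℤ.+ n) = begin
      fromℤ (ℤ.+ m ℤ.* ℤ.+ n)   ≡⟨ ≡.cong fromℤ (ℤ.pos-* m n) ⟨
      fromℕ (m ℕ.* n)       ≈⟨ ×1-homo-* m n ⟩
      fromℕ m * fromℕ n     ∎
    nonneg m -[1+ n ] = begin
      fromℤ (ℤ.+ m ℤ.* -[1+ n ])         ≡⟨ ≡.cong fromℤ (ℤ.neg-distribʳ-* (ℤ.+ m) (ℤ.+ suc n)) ⟨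
      fromℤ (ℤ.- (ℤ.+ m ℤ.* ℤ.+ suc n))    ≈⟨ fromℤ-neg (ℤ.+ m ℤ.* ℤ.+ suc n) ⟩
      - fromℤ (ℤ.+ m ℤ.* ℤ.+ suc n)        ≈⟨ -‿cong (nonneg m (ℤ.+ suc n)) ⟩
      - (fromℕ m * fromℕ (suc n))      ≈⟨ -‿distribʳ-* _ _ ⟩
      fromℕ m * - fromℕ (suc n)        ∎
  fromℤ-* -[1+ m ] j = begin
    fromℤ (-[1+ m ] ℤ.* j)           ≡⟨ ≡.cong fromℤ (ℤ.neg-distribˡ-* (ℤ.+ suc m) j) ⟨
    fromℤ (ℤ.- (ℤ.+ suc m ℤ.* j))      ≈⟨ fromℤ-neg (ℤ.+ suc m ℤ.* j) ⟩
    - fromℤ (ℤ.+ suc m ℤ.* j)          ≈⟨ -‿cong (fromℤ-* (ℤ.+ suc m) j) ⟩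
    - (fromℕ (suc m) * fromℤ j)      ≈⟨ -‿distribˡ-* _ _ ⟩
    - fromℕ (suc m) * fromℤ j        ∎

  fromℤ-sum : ∀ n (f : Fin n → ℤ) → fromℤ (ℤsum f) ≈ sum λ i → fromℤ (f i)
  fromℤ-sum zero    f = refl
  fromℤ-sum (suc n) f =
    trans (fromℤ-+ (f zero) (ℤsum λ i → f (suc i))) (+-congˡ (fromℤ-sum n λ i → f (suc i)))

  identityMatrix≈δ : ∀ n i j → identityMatrix ℝ n i j ≈ δ i j
  identityMatrix≈δ (suc n) i j with i Fin.≟ j
  identityMatrix≈δ (suc n) zero    zero    | yes _   = refl
  identityMatrix≈δ (suc n) zero    zero    | no 0≢0  = contradiction ≡.refl 0≢0
  identityMatrix≈δ (suc n) zero    (suc j) | no _    = refl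
  identityMatrix≈δ (suc n) (suc i) zero    | no _    = refl
  identityMatrix≈δ (suc n) (suc i) (suc j) | i≟j
    with i Fin.≟ j | i≟j | identityMatrix≈δ n i j
  ... | yes _      | yes _     | eq = eq
  ... | no _       | no _      | eq = eq
  ... | yes ≡.refl | no i≢j    | eq = contradiction ≡.refl i≢j
  ... | no i≢j     | yes ≡.refl | eq = contradiction ≡.refl i≢j

  sumOfSquares≈trace : ∀ {n} (M : Matrix ℤ n n) λs → IsNonzeroSpectrum ℝ M λs →
    sumOfSquares ℝ λs ≈ fromℤ (ℤsum λ i → ℤsum λ j → M i j ℤ.* M j i)
  sumOfSquares≈trace {n} M λs spectrum = +-cancelʳ (e + e) _ _ (begin
    sumOfSquares ℝ λs + (e + e)                    ≈⟨ +-congˡ (+-cong (agree 2) (agree 2)) ⟩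
    sumOfSquares ℝ λs + (rootCoeff λs 2 + rootCoeff λs 2) ≈⟨ newton-roots λs ⟨
    rootCoeff λs 1 * rootCoeff λs 1                ≈⟨ *-cong (agree 1) (agree 1) ⟨
    pencilCoeff δ B 1 * pencilCoeff δ B 1          ≈⟨ *-cong (pencilCoeff₁-δ B) (pencilCoeff₁-δ B) ⟩
    trace B * trace B                              ≈⟨ newton-matrix B ⟩
    trace² B + (e + e)                             ≈⟨ +-congʳ trace²≈ ⟩
    fromℤ (ℤsum λ i → ℤsum λ j → M i j ℤ.* M j i) + (e + e) ∎)
    where
    open IsNonzeroSpectrum spectrum

    -- The characteristic polynomial is the pencil of the identity and -M; the sign drops out of the
    -- products of two entries in `trace² B`.
    B : Matrix Carrier n n
    B i j = - fromℤ (M i j)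

    e = pencilCoeff δ B 2

    factor : ∀ t → horner n (pencilCoeff δ B) t ≈ horner (z ℕ.+ length λs) (rootCoeff λs) t
    factor t = begin
      horner n (pencilCoeff δ B) t
        ≈⟨ horner-cong n (λ i → sym (pencilCoeff-cong B (identityMatrix≈δ n) i)) t ⟩
      horner n (pencilCoeff (identityMatrix ℝ n) B) t
        ≈⟨ det-pencil (identityMatrix ℝ n) B t ⟨
      charPoly ℝ M t
        ≈⟨ factorisation t ⟩
      t ^ z * foldr (λ x p → (t - x) * p) 1# λs
        ≈⟨ *-congˡ (product-roots λs t) ⟩
      t ^ z * horner (length λs) (rootCoeff λs) t
        ≈⟨ horner-^ z (length λs) (rootCoeff-bounded λs) t ⟨
      horner (z ℕ.+ length λs) (rootCoeff λs) t ∎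

    agree : ∀ i → pencilCoeff δ B i ≈ rootCoeff λs i
    agree = monic-unique n (z ℕ.+ length λs) (pencilCoeff δ B) (rootCoeff λs)
      (pencilCoeff₀-δ B) (rootCoeff₀ λs) (pencilCoeff-bounded δ B)
      (λ i z+d<i → rootCoeff-bounded λs i (ℕ.≤-<-trans (ℕ.m≤n+m (length λs) z) z+d<i))
      factor

    entry : ∀ i j → B i j * B j i ≈ fromℤ (M i j ℤ.* M j i)
    entry i j = begin
      - x * - y     ≈⟨ -‿distribˡ-* x (- y) ⟨
      - (x * - y)   ≈⟨ -‿cong (-‿distribʳ-* x y) ⟨
      - - (x * y)   ≈⟨ -‿involutive _ ⟩
      x * y         ≈⟨ fromℤ-* (M i j) (M j i) ⟨
      fromℤ (M i j ℤ.* M j i) ∎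
      where
      x = fromℤ (M i j)
      y = fromℤ (M j i)

    trace²≈ : trace² B ≈ fromℤ (ℤsum λ i → ℤsum λ j → M i j ℤ.* M j i)
    trace²≈ = begin
      trace² B
        ≈⟨ sum-cong-≋ (λ i → sum-cong-≋ (entry i)) ⟩
      sum (λ i → sum λ j → fromℤ (M i j ℤ.* M j i))
        ≈⟨ sum-cong-≋ (λ i → fromℤ-sum n λ j → M i j ℤ.* M j i) ⟨
      sum (λ i → fromℤ (ℤsum λ j → M i j ℤ.* M j i))
        ≈⟨ fromℤ-sum n (λ i → ℤsum λ j → M i j ℤ.* M j i) ⟨
      fromℤ (ℤsum λ i → ℤsum λ j → M i j ℤ.* M j i) ∎

-- Facets and shifts

module Moments where
  open import Data.Integer.Base using (0ℤ; 1ℤ; -1ℤ; _+_; _*_; _-_) renaming (+_ to pos)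
  open ≡ using (refl; sym; trans; cong; cong₂; subst)
  open ≡.≡-Reasoning

  -- Finite sums over lists

  module _ {a} {A : Set a} where

    -- Has the shape of the fold in `sumOfShiftDefects`, which is thus a `∑` by definition. Values
    -- lie in `ℤ` so that differences and signs need no separate treatment.
    ∑ : List A → (A → ℤ) → ℤ
    ∑ xs f = foldr (λ x s → f x + s) 0ℤ xs

    ∑-cong : ∀ xs {f g : A → ℤ} → (∀ x → f x ≡ g x) → ∑ xs f ≡ ∑ xs g
    ∑-cong []       f≗g = refl
    ∑-cong (x ∷ xs) f≗g = cong₂ _+_ (f≗g x) (∑-cong xs f≗g)

    ∑-0 : ∀ (xs : List A) → ∑ xs (λ _ → 0ℤ) ≡ 0ℤ
    ∑-0 []       = refl
    ∑-0 (x ∷ xs) = trans (ℤ.+-identityˡ _) (∑-0 xs)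

    ∑-+ : ∀ xs (f g : A → ℤ) → ∑ xs (λ x → f x + g x) ≡ ∑ xs f + ∑ xs g
    ∑-+ []       f g = refl
    ∑-+ (x ∷ xs) f g = trans (cong ((f x + g x) +_) (∑-+ xs f g)) (rearrange (f x) (g x) (∑ xs f) (∑ xs g))
      where
      rearrange : ∀ a b s t → (a + b) + (s + t) ≡ (a + s) + (b + t)
      rearrange = solve-∀

    ∑-*ˡ : ∀ xs c (f : A → ℤ) → ∑ xs (λ x → c * f x) ≡ c * ∑ xs f
    ∑-*ˡ []       c f = sym (ℤ.*-zeroʳ c)
    ∑-*ˡ (x ∷ xs) c f = trans (cong (c * f x +_) (∑-*ˡ xs c f)) (sym (ℤ.*-distribˡ-+ c _ _))

    ∑-*ʳ : ∀ xs c (f : A → ℤ) → ∑ xs (λ x → f x * c) ≡ ∑ xs f * c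
    ∑-*ʳ xs c f = begin
      ∑ xs (λ x → f x * c) ≡⟨ ∑-cong xs (λ x → ℤ.*-comm (f x) c) ⟩
      ∑ xs (λ x → c * f x) ≡⟨ ∑-*ˡ xs c f ⟩
      c * ∑ xs f           ≡⟨ ℤ.*-comm c _ ⟩
      ∑ xs f * c           ∎

    ∑-++ : ∀ xs ys (f : A → ℤ) → ∑ (xs ++ ys) f ≡ ∑ xs f + ∑ ys f
    ∑-++ []       ys f = sym (ℤ.+-identityˡ _)
    ∑-++ (x ∷ xs) ys f = trans (cong (f x +_) (∑-++ xs ys f)) (sym (ℤ.+-assoc (f x) _ _))

  ∑-map : ∀ {a b} {A : Set a} {B : Set b} (h : A → B) xs (f : B → ℤ) → ∑ (map h xs) f ≡ ∑ xs (f ∘ h)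
  ∑-map h []       f = refl
  ∑-map h (x ∷ xs) f = cong (f (h x) +_) (∑-map h xs f)

  module _ {a b} {A : Set a} {B : Set b} where

    ∑-comm : ∀ (xs : List A) (ys : List B) (f : A → B → ℤ) →
             ∑ xs (λ x → ∑ ys (f x)) ≡ ∑ ys (λ y → ∑ xs λ x → f x y)
    ∑-comm []       ys f = sym (∑-0 ys)
    ∑-comm (x ∷ xs) ys f =
      trans (cong (∑ ys (f x) +_) (∑-comm xs ys f)) (sym (∑-+ ys (f x) _))

    ∑-*-∑ : ∀ (xs : List A) (ys : List B) (f : A → ℤ) (g : B → ℤ) →
            ∑ xs f * ∑ ys g ≡ ∑ xs (λ x → ∑ ys λ y → f x * g y)
    ∑-*-∑ xs ys f g =
      sym (trans (∑-cong xs λ x → ∑-*ˡ ys (f x) g) (∑-*ʳ xs (∑ ys g) f))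

    ∑-cartesianProduct : ∀ (xs : List A) (ys : List B) (f : A × B → ℤ) →
      ∑ (cartesianProduct xs ys) f ≡ ∑ xs (λ x → ∑ ys λ y → f (x , y))
    ∑-cartesianProduct []       ys f = refl
    ∑-cartesianProduct (x ∷ xs) ys f = begin
      ∑ (map (x ,_) ys ++ cartesianProduct xs ys) f
        ≡⟨ ∑-++ (map (x ,_) ys) _ f ⟩
      ∑ (map (x ,_) ys) f + ∑ (cartesianProduct xs ys) f
        ≡⟨ cong₂ _+_ (∑-map (x ,_) ys f) (∑-cartesianProduct xs ys f) ⟩
      _ ∎

  -- Indicators: counts as sums

  𝟙 : ∀ {p} {P : Set p} → Dec P → ℤ
  𝟙 P? = if does P? then 1ℤ else 0ℤ

  module _ {p} {P : Set p} where

    𝟙-yes : (P? : Dec P) → P → 𝟙 P? ≡ 1ℤ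
    𝟙-yes (yes _) p = refl
    𝟙-yes (no ¬p) p = contradiction p ¬p

    𝟙-no : (P? : Dec P) → ¬ P → 𝟙 P? ≡ 0ℤ
    𝟙-no (yes p) ¬p = contradiction p ¬p
    𝟙-no (no _)  ¬p = refl

    𝟙-¬ : (P? : Dec P) → 𝟙 (¬? P?) ≡ 1ℤ - 𝟙 P?
    𝟙-¬ (yes _) = refl
    𝟙-¬ (no _)  = refl

    𝟙-guard : (P? : Dec P) {x y : ℤ} → (P → x ≡ y) → 𝟙 P? * x ≡ 𝟙 P? * y
    𝟙-guard (yes p) eq = cong (1ℤ *_) (eq p)
    𝟙-guard (no _)  eq = refl

  module _ {p q} {P : Set p} {Q : Set q} where

    𝟙-cong : (P? : Dec P) (Q? : Dec Q) → (P → Q) → (Q → P) → 𝟙 P? ≡ 𝟙 Q?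
    𝟙-cong P? (yes q) P→Q Q→P = 𝟙-yes P? (Q→P q)
    𝟙-cong P? (no ¬q) P→Q Q→P = 𝟙-no P? (¬q ∘ P→Q)

    𝟙-× : (P? : Dec P) (Q? : Dec Q) → 𝟙 (P? ×-dec Q?) ≡ 𝟙 P? * 𝟙 Q?
    𝟙-× (yes _) (yes _) = refl
    𝟙-× (yes _) (no _)  = refl
    𝟙-× (no _)  _       = refl

  module _ {a p} {A : Set a} {P : Pred A p} (P? : Decidable P) where

    ∑-filter : ∀ xs f → ∑ (filter P? xs) f ≡ ∑ xs (λ x → 𝟙 (P? x) * f x)
    ∑-filter []       f = refl
    ∑-filter (x ∷ xs) f with P? x
    ... | yes _ = cong₂ _+_ (sym (ℤ.*-identityˡ (f x))) (∑-filter xs f)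
    ... | no _  = trans (∑-filter xs f) (sym (ℤ.+-identityˡ _))

    ∑-filter-cong : ∀ xs {f g} → (∀ x → P x → f x ≡ g x) → ∑ (filter P? xs) f ≡ ∑ (filter P? xs) g
    ∑-filter-cong xs {f} {g} f≗g = begin
      ∑ (filter P? xs) f          ≡⟨ ∑-filter xs f ⟩
      ∑ xs (λ x → 𝟙 (P? x) * f x) ≡⟨ ∑-cong xs (λ x → 𝟙-guard (P? x) (f≗g x)) ⟩
      ∑ xs (λ x → 𝟙 (P? x) * g x) ≡⟨ ∑-filter xs g ⟨
      ∑ (filter P? xs) g          ∎

    length-filter : ∀ xs → pos (length (filter P? xs)) ≡ ∑ xs (λ x → 𝟙 (P? x))
    length-filter []       = refl
    length-filter (x ∷ xs) with P? x
    ... | yes _ = cong (1ℤ +_) (length-filter xs)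
    ... | no _  = trans (length-filter xs) (sym (ℤ.+-identityˡ _))

  ℤsum-cong : ∀ n {f g : Fin n → ℤ} → (∀ i → f i ≡ g i) → ℤsum f ≡ ℤsum g
  ℤsum-cong zero    f≗g = refl
  ℤsum-cong (suc n) f≗g = cong₂ _+_ (f≗g zero) (ℤsum-cong n (f≗g ∘ suc))

  ℤsum-lookup : ∀ {a} {A : Set a} (xs : List A) (f : A → ℤ) → ℤsum (λ i → f (lookup xs i)) ≡ ∑ xs f
  ℤsum-lookup []       f = refl
  ℤsum-lookup (x ∷ xs) f = cong (f x +_) (ℤsum-lookup xs f)

  ∑-allFin-suc : ∀ n (f : Fin (suc n) → ℤ) →
                 ∑ (allFin (suc n)) f ≡ f zero + ∑ (allFin n) (f ∘ suc)
  ∑-allFin-suc n f = cong (f zero +_) (begin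
    ∑ (tabulate suc) f         ≡⟨ cong (λ xs → ∑ xs f) (List.map-tabulate (λ i → i) suc) ⟨
    ∑ (map suc (allFin n)) f   ≡⟨ ∑-map suc (allFin n) f ⟩
    ∑ (allFin n) (f ∘ suc)     ∎)

  ∑-allFin-≟ : ∀ {n} (y : Fin n) (f : Fin n → ℤ) → ∑ (allFin n) (λ x → 𝟙 (x Fin.≟ y) * f x) ≡ f y
  ∑-allFin-≟ {suc n} zero f = begin
    ∑ (allFin (suc n)) (λ x → 𝟙 (x Fin.≟ zero) * f x)
      ≡⟨ ∑-allFin-suc n (λ x → 𝟙 (x Fin.≟ zero) * f x) ⟩
    1ℤ * f zero + ∑ (allFin n) (λ x → 𝟙 (suc x Fin.≟ zero) * f (suc x))
      ≡⟨ cong₂ _+_ (ℤ.*-identityˡ (f zero)) (∑-0 (allFin n)) ⟩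
    f zero + 0ℤ
      ≡⟨ ℤ.+-identityʳ _ ⟩
    f zero ∎
  ∑-allFin-≟ {suc n} (suc y) f = begin
    ∑ (allFin (suc n)) (λ x → 𝟙 (x Fin.≟ suc y) * f x)
      ≡⟨ ∑-allFin-suc n (λ x → 𝟙 (x Fin.≟ suc y) * f x) ⟩
    0ℤ + ∑ (allFin n) (λ x → 𝟙 (suc x Fin.≟ suc y) * f (suc x))
      ≡⟨ ℤ.+-identityˡ _ ⟩
    ∑ (allFin n) (λ x → 𝟙 (suc x Fin.≟ suc y) * f (suc x))
      ≡⟨ ∑-cong (allFin n) (λ x → cong (_* f (suc x))
           (𝟙-cong (suc x Fin.≟ suc y) (x Fin.≟ y) Fin.suc-injective (cong suc))) ⟩
    ∑ (allFin n) (λ x → 𝟙 (x Fin.≟ y) * f (suc x))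
      ≡⟨ ∑-allFin-≟ y (f ∘ suc) ⟩
    f (suc y) ∎

  -- Encodes that `allSubsets` lists every subset exactly once: of its two halves, only the one with
  -- the same head as τ can contain τ.
  ∑-allSubsets-≟ : ∀ {n} (τ : Subset n) (f : Subset n → ℤ) → ∑ (allSubsets n) (λ σ → 𝟙 (σ ≟ˢ τ) * f σ) ≡ f τ
  ∑-allSubsets-≟ {zero} [] f = trans (ℤ.+-identityʳ _) (ℤ.*-identityˡ (f []))
  ∑-allSubsets-≟ {suc n} (t ∷ τ) f = begin
    ∑ (allSubsets (suc n)) g
      ≡⟨ ∑-++ (map (outside ∷_) (allSubsets n)) _ g ⟩
    ∑ (map (outside ∷_) (allSubsets n)) g + ∑ (map (inside ∷_) (allSubsets n)) g
      ≡⟨ cong₂ _+_ (∑-map (outside ∷_) (allSubsets n) g) (∑-map (inside ∷_) (allSubsets n) g) ⟩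
    ∑ (allSubsets n) (λ σ → g (outside ∷ σ)) + ∑ (allSubsets n) (λ σ → g (inside ∷ σ))
      ≡⟨ halves t refl ⟩
    f (t ∷ τ) ∎
    where
    g : Subset (suc n) → ℤ
    g σ = 𝟙 (σ ≟ˢ (t ∷ τ)) * f σ

    same : ∀ {s} → s ≡ t → ∑ (allSubsets n) (λ σ → g (s ∷ σ)) ≡ f (t ∷ τ)
    same refl = trans
      (∑-cong (allSubsets n) λ σ → cong (_* f (t ∷ σ))
        (𝟙-cong ((t ∷ σ) ≟ˢ (t ∷ τ)) (σ ≟ˢ τ) Vec.∷-injectiveʳ (cong (t ∷_))))
      (∑-allSubsets-≟ τ (λ σ → f (t ∷ σ)))

    different : ∀ {s} → s ≢ t → ∑ (allSubsets n) (λ σ → g (s ∷ σ)) ≡ 0ℤ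
    different {s} s≢t = trans
      (∑-cong (allSubsets n) λ σ → cong (_* f (s ∷ σ))
        (𝟙-no ((s ∷ σ) ≟ˢ (t ∷ τ)) (s≢t ∘ Vec.∷-injectiveˡ)))
      (∑-0 (allSubsets n))

    halves : ∀ s → s ≡ t → ∑ (allSubsets n) (λ σ → g (outside ∷ σ)) +
                           ∑ (allSubsets n) (λ σ → g (inside ∷ σ)) ≡ f (t ∷ τ)
    halves outside refl = trans (cong₂ _+_ (same refl) (different {inside} λ ())) (ℤ.+-identityʳ _)
    halves inside  refl = trans (cong₂ _+_ (different {outside} λ ()) (same refl)) (ℤ.+-identityˡ _)

  ∑-membership : ∀ {n} (σ : Subset n) → ∑ (allFin n) (λ v → 𝟙 (v ∈? σ)) ≡ pos ∣ σ ∣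
  ∑-membership []          = refl
  ∑-membership {suc n} (s ∷ σ) = begin
    ∑ (allFin (suc n)) (λ v → 𝟙 (v ∈? s ∷ σ))
      ≡⟨ ∑-allFin-suc n (λ v → 𝟙 (v ∈? s ∷ σ)) ⟩
    𝟙 (zero ∈? s ∷ σ) + ∑ (allFin n) (λ v → 𝟙 (suc v ∈? s ∷ σ))
      ≡⟨ cong (𝟙 (zero ∈? s ∷ σ) +_) (trans
           (∑-cong (allFin n) λ v → 𝟙-cong (suc v ∈? s ∷ σ) (v ∈? σ) Subset.drop-there there)
           (∑-membership σ)) ⟩
    𝟙 (zero ∈? s ∷ σ) + pos ∣ σ ∣
      ≡⟨ head s ⟩
    pos ∣ s ∷ σ ∣ ∎
    where
    head : ∀ s → 𝟙 (zero ∈? s ∷ σ) + pos ∣ σ ∣ ≡ pos ∣ s ∷ σ ∣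
    head outside = ℤ.+-identityˡ _
    head inside  = refl

  -- Deleting and adding a vertex

  x∉p-x : ∀ {n} (p : Subset n) x → x ∉ p ∖ x
  x∉p-x (s ∷ p) (suc x) (there x∈) = x∉p-x p x x∈

  x∈p-y⇒x∈p : ∀ {n} {p : Subset n} {x} y → x ∈ p ∖ y → x ∈ p
  x∈p-y⇒x∈p {p = p} y = Subset.p─q⊆p p ⁅ y ⁆

  ∣p-x∣ : ∀ {n} {p : Subset n} {x} → x ∈ p → suc ∣ p ∖ x ∣ ≡ ∣ p ∣
  ∣p-x∣ {p = inside ∷ p}  here       = cong (suc ∘ ∣_∣) (Subset.p─⊥≡p p)
  ∣p-x∣ {p = inside ∷ p}  (there x∈) = cong suc (∣p-x∣ x∈)
  ∣p-x∣ {p = outside ∷ p} (there x∈) = ∣p-x∣ x∈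

  p-x∪x : ∀ {n} {p : Subset n} {x} → x ∈ p → (p ∖ x) ∪ ⁅ x ⁆ ≡ p
  p-x∪x {p = p} {x} x∈p = Subset.⊆-antisym to from
    where
    to : (p ∖ x) ∪ ⁅ x ⁆ ⊆ p
    to y∈ with Subset.x∈p∪q⁻ (p ∖ x) ⁅ x ⁆ y∈
    ... | inj₁ y∈p-x = x∈p-y⇒x∈p x y∈p-x
    ... | inj₂ y∈x with refl ← Subset.x∈⁅y⁆⇒x≡y x y∈x = x∈p

    from : p ⊆ (p ∖ x) ∪ ⁅ x ⁆
    from {y} y∈p with y Fin.≟ x
    ... | yes refl = Subset.x∈p∪q⁺ (inj₂ (Subset.x∈⁅x⁆ x))
    ... | no y≢x   = Subset.x∈p∪q⁺ (inj₁ (Subset.x∈p∧x≢y⇒x∈p-y y∈p y≢x))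

  p∪x-x : ∀ {n} {p : Subset n} {x} → x ∉ p → (p ∪ ⁅ x ⁆) ∖ x ≡ p
  p∪x-x {p = p} {x} x∉p = Subset.⊆-antisym to from
    where
    to : (p ∪ ⁅ x ⁆) ∖ x ⊆ p
    to {y} y∈ with Subset.x∈p∪q⁻ p ⁅ x ⁆ (x∈p-y⇒x∈p x y∈)
    ... | inj₁ y∈p = y∈p
    ... | inj₂ y∈x with refl ← Subset.x∈⁅y⁆⇒x≡y x y∈x = contradiction y∈ (x∉p-x (p ∪ ⁅ x ⁆) x)

    from : p ⊆ (p ∪ ⁅ x ⁆) ∖ x
    from y∈p = Subset.x∈p∧x≢y⇒x∈p-y (Subset.x∈p∪q⁺ (inj₁ y∈p)) λ where refl → x∉p y∈p

  x∈p∪x : ∀ {n} (p : Subset n) x → x ∈ p ∪ ⁅ x ⁆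
  x∈p∪x p x = Subset.x∈p∪q⁺ (inj₂ (Subset.x∈⁅x⁆ x))

  swap-* : ∀ a b c → a * (b * c) ≡ b * (a * c)
  swap-* = solve-∀

  -- Sums over faces and the covering relation

  module Complex {n} (K : SimplicialComplex n) where

    ∑-faces-≟ : ∀ m τ (f : Subset n → ℤ) →
      ∑ (facesOfSize K m) (λ σ → 𝟙 (σ ≟ˢ τ) * f σ) ≡ 𝟙 (faceOfSize? K m τ) * f τ
    ∑-faces-≟ m τ f = begin
      ∑ (facesOfSize K m) (λ σ → 𝟙 (σ ≟ˢ τ) * f σ)
        ≡⟨ ∑-filter (faceOfSize? K m) (allSubsets n) _ ⟩
      ∑ (allSubsets n) (λ σ → 𝟙 (faceOfSize? K m σ) * (𝟙 (σ ≟ˢ τ) * f σ))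
        ≡⟨ ∑-cong (allSubsets n) (λ σ → swap-* (𝟙 (faceOfSize? K m σ)) (𝟙 (σ ≟ˢ τ)) (f σ)) ⟩
      ∑ (allSubsets n) (λ σ → 𝟙 (σ ≟ˢ τ) * (𝟙 (faceOfSize? K m σ) * f σ))
        ≡⟨ ∑-allSubsets-≟ τ _ ⟩
      𝟙 (faceOfSize? K m τ) * f τ ∎

    ∑-faces-cong : ∀ m {f g : Subset n → ℤ} → (∀ σ → FaceOfSize K m σ → f σ ≡ g σ) →
                   ∑ (facesOfSize K m) f ≡ ∑ (facesOfSize K m) g
    ∑-faces-cong m = ∑-filter-cong (faceOfSize? K m) (allSubsets n)

    -- Equals [σ:F]² (incidence² below).
    covers : Subset n → Subset n → ℤ
    covers σ F = ∑ (allFin n) λ v → 𝟙 (v ∈? F) * 𝟙 (σ ≟ˢ (F ∖ v))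

    -- Deleting v from F and adding v to σ are inverse to each other, so the two sums agree term by
    -- term. This reads the relation from below, as needed to sum over the facets above a fixed σ.
    covers-∪ : ∀ σ F → covers σ F ≡ ∑ (allFin n) λ v → 𝟙 (¬? (v ∈? σ)) * 𝟙 (F ≟ˢ (σ ∪ ⁅ v ⁆))
    covers-∪ σ F = ∑-cong (allFin n) λ v → begin
      𝟙 (v ∈? F) * 𝟙 (σ ≟ˢ (F ∖ v))
        ≡⟨ 𝟙-× (v ∈? F) (σ ≟ˢ (F ∖ v)) ⟨
      𝟙 (v ∈? F ×-dec σ ≟ˢ (F ∖ v))
        ≡⟨ 𝟙-cong (v ∈? F ×-dec σ ≟ˢ (F ∖ v)) (¬? (v ∈? σ) ×-dec F ≟ˢ (σ ∪ ⁅ v ⁆))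
             (λ where (v∈F , refl) → x∉p-x F v , sym (p-x∪x v∈F))
             (λ where (v∉σ , refl) → x∈p∪x σ v , sym (p∪x-x v∉σ)) ⟩
      𝟙 (¬? (v ∈? σ) ×-dec F ≟ˢ (σ ∪ ⁅ v ⁆))
        ≡⟨ 𝟙-× (¬? (v ∈? σ)) (F ≟ˢ (σ ∪ ⁅ v ⁆)) ⟩
      𝟙 (¬? (v ∈? σ)) * 𝟙 (F ≟ˢ (σ ∪ ⁅ v ⁆)) ∎

    ∑-faces-∑ : ∀ m (P : Fin n → ℤ) (τ : Fin n → Subset n) (f : Subset n → ℤ) →
      ∑ (facesOfSize K m) (λ σ → ∑ (allFin n) (λ v → P v * 𝟙 (σ ≟ˢ τ v)) * f σ) ≡
      ∑ (allFin n) λ v → P v * (𝟙 (faceOfSize? K m (τ v)) * f (τ v))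
    ∑-faces-∑ m P τ f = begin
      ∑ Y (λ σ → ∑ (allFin n) (λ v → P v * 𝟙 (σ ≟ˢ τ v)) * f σ)
        ≡⟨ ∑-cong Y (λ σ → sym (∑-*ʳ (allFin n) (f σ) λ v → P v * 𝟙 (σ ≟ˢ τ v))) ⟩
      ∑ Y (λ σ → ∑ (allFin n) λ v → P v * 𝟙 (σ ≟ˢ τ v) * f σ)
        ≡⟨ ∑-comm Y (allFin n) (λ σ v → P v * 𝟙 (σ ≟ˢ τ v) * f σ) ⟩
      ∑ (allFin n) (λ v → ∑ Y λ σ → P v * 𝟙 (σ ≟ˢ τ v) * f σ)
        ≡⟨ ∑-cong (allFin n) (λ v → begin
             ∑ Y (λ σ → P v * 𝟙 (σ ≟ˢ τ v) * f σ)
               ≡⟨ ∑-cong Y (λ σ → ℤ.*-assoc (P v) (𝟙 (σ ≟ˢ τ v)) (f σ)) ⟩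
             ∑ Y (λ σ → P v * (𝟙 (σ ≟ˢ τ v) * f σ))
               ≡⟨ ∑-*ˡ Y (P v) _ ⟩
             P v * ∑ Y (λ σ → 𝟙 (σ ≟ˢ τ v) * f σ)
               ≡⟨ cong (P v *_) (∑-faces-≟ m (τ v) f) ⟩
             P v * (𝟙 (faceOfSize? K m (τ v)) * f (τ v)) ∎) ⟩
      ∑ (allFin n) (λ v → P v * (𝟙 (faceOfSize? K m (τ v)) * f (τ v))) ∎
      where Y = facesOfSize K m

    facet-boundary : ∀ {m F v} → FaceOfSize K (suc m) F → v ∈ F → FaceOfSize K m (F ∖ v)
    facet-boundary {v = v} (F∈K , ∣F∣) v∈F =
      downClosed K (x∈p-y⇒x∈p v) F∈K , ℕ.suc-injective (trans (∣p-x∣ v∈F) ∣F∣)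

    ∑-boundary : ∀ {m F} → FaceOfSize K (suc m) F → ∀ (f : Subset n → ℤ) →
      ∑ (facesOfSize K m) (λ σ → covers σ F * f σ) ≡ ∑ (allFin n) λ v → 𝟙 (v ∈? F) * f (F ∖ v)
    ∑-boundary {m} {F} F∈K f = trans (∑-faces-∑ m (λ v → 𝟙 (v ∈? F)) (F ∖_) f) (∑-cong (allFin n) λ v →
      𝟙-guard (v ∈? F) λ v∈F → trans
        (cong (_* f (F ∖ v)) (𝟙-yes (faceOfSize? K m (F ∖ v)) (facet-boundary F∈K v∈F)))
        (ℤ.*-identityˡ _))

    -- In `∑-boundary` the face test disappears by downward closure. Here it stays, and it later
    -- becomes the condition that a shift succeeds.
    ∑-coboundary : ∀ m σ (f : Subset n → ℤ) →
      ∑ (facesOfSize K m) (λ F → covers σ F * f F) ≡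
      ∑ (allFin n) λ v → 𝟙 (¬? (v ∈? σ)) * (𝟙 (faceOfSize? K m (σ ∪ ⁅ v ⁆)) * f (σ ∪ ⁅ v ⁆))
    ∑-coboundary m σ f = trans
      (∑-cong (facesOfSize K m) λ F → cong (_* f F) (covers-∪ σ F))
      (∑-faces-∑ m (λ v → 𝟙 (¬? (v ∈? σ))) (λ v → σ ∪ ⁅ v ⁆) f)

    covers-size : ∀ {m F} → FaceOfSize K (suc m) F →
                  ∑ (facesOfSize K m) (λ σ → covers σ F) ≡ pos (suc m)
    covers-size {m} {F} F∈K@(_ , ∣F∣) = begin
      ∑ (facesOfSize K m) (λ σ → covers σ F)
        ≡⟨ ∑-cong (facesOfSize K m) (λ σ → ℤ.*-identityʳ (covers σ F)) ⟨
      ∑ (facesOfSize K m) (λ σ → covers σ F * 1ℤ)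
        ≡⟨ ∑-boundary F∈K (λ _ → 1ℤ) ⟩
      ∑ (allFin n) (λ v → 𝟙 (v ∈? F) * 1ℤ)
        ≡⟨ ∑-cong (allFin n) (λ v → ℤ.*-identityʳ (𝟙 (v ∈? F))) ⟩
      ∑ (allFin n) (λ v → 𝟙 (v ∈? F))
        ≡⟨ ∑-membership F ⟩
      pos ∣ F ∣
        ≡⟨ cong pos ∣F∣ ⟩
      pos (suc m) ∎

    covers-once : ∀ {σ F v} → v ∈ F → F ∖ v ≡ σ → covers σ F ≡ 1ℤ
    covers-once {F = F} {v₀} v₀∈F refl = begin
      covers (F ∖ v₀) F
        ≡⟨ ∑-cong (allFin n) (λ v → begin
             𝟙 (v ∈? F) * 𝟙 ((F ∖ v₀) ≟ˢ (F ∖ v))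
               ≡⟨ 𝟙-× (v ∈? F) ((F ∖ v₀) ≟ˢ (F ∖ v)) ⟨
             𝟙 (v ∈? F ×-dec (F ∖ v₀) ≟ˢ (F ∖ v))
               ≡⟨ 𝟙-cong (v ∈? F ×-dec (F ∖ v₀) ≟ˢ (F ∖ v)) (v Fin.≟ v₀) same (λ where refl → v₀∈F , refl) ⟩
             𝟙 (v Fin.≟ v₀)
               ≡⟨ ℤ.*-identityʳ _ ⟨
             𝟙 (v Fin.≟ v₀) * 1ℤ ∎) ⟩
      ∑ (allFin n) (λ v → 𝟙 (v Fin.≟ v₀) * 1ℤ)
        ≡⟨ ∑-allFin-≟ v₀ (λ _ → 1ℤ) ⟩
      1ℤ ∎
      where
      same : ∀ {v} → v ∈ F × F ∖ v₀ ≡ F ∖ v → v ≡ v₀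
      same {v} (v∈F , eq) with v Fin.≟ v₀
      ... | yes v≡v₀ = v≡v₀
      ... | no v≢v₀  = contradiction (subst (v ∈_) eq (Subset.x∈p∧x≢y⇒x∈p-y v∈F v≢v₀)) (x∉p-x F v)

    covers-none : ∀ {σ F} → (∀ v → v ∈ F → F ∖ v ≢ σ) → covers σ F ≡ 0ℤ
    covers-none {σ} {F} none = trans
      (∑-cong (allFin n) λ v → trans
        (𝟙-guard (v ∈? F) λ v∈F → 𝟙-no (σ ≟ˢ (F ∖ v)) (none v v∈F ∘ sym))
        (ℤ.*-zeroʳ (𝟙 (v ∈? F))))
      (∑-0 (allFin n))

    -- Distinct σ and σ′ come from deleting distinct vertices, so every vertex of F survives in one
    -- of them; both contain only vertices of G. The situation is symmetric in F and G.
    cover-unique : ∀ {σ σ′ F G : Subset n} {v v′ w w′} → F ∖ v ≡ σ → F ∖ v′ ≡ σ′ →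
      G ∖ w ≡ σ → G ∖ w′ ≡ σ′ → σ ≢ σ′ → F ≡ G
    cover-unique Fv Fv′ Gw Gw′ σ≢σ′ =
      Subset.⊆-antisym (included Fv Fv′ Gw Gw′) (included Gw Gw′ Fv Fv′)
      where
      included : ∀ {F G v v′ w w′} → F ∖ v ≡ _ → F ∖ v′ ≡ _ → G ∖ w ≡ _ → G ∖ w′ ≡ _ → F ⊆ G
      included {v = v} {v′} {w} {w′} Fv Fv′ Gw Gw′ {x} x∈F with x Fin.≟ v
      ... | no x≢v = x∈p-y⇒x∈p w
        (subst (x ∈_) (trans Fv (sym Gw)) (Subset.x∈p∧x≢y⇒x∈p-y x∈F x≢v))
      ... | yes refl = x∈p-y⇒x∈p w′
        (subst (x ∈_) (trans Fv′ (sym Gw′)) (Subset.x∈p∧x≢y⇒x∈p-y x∈F λ where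
          refl → σ≢σ′ (trans (sym Fv) Fv′)))

  -- The Gram matrix of the columns of the boundary matrix

  neg1^-square : ∀ m → -1ℤ ℤ.^ m * -1ℤ ℤ.^ m ≡ 1ℤ
  neg1^-square zero    = refl
  neg1^-square (suc m) = trans (rearrange (-1ℤ ℤ.^ m)) (neg1^-square m)
    where
    rearrange : ∀ x → (-1ℤ * x) * (-1ℤ * x) ≡ x * x
    rearrange = solve-∀

  module Gram {n} {K : SimplicialComplex n} (o : Orientation K) where
    open Orientation o
    open Complex K

    -- The orientation is forgotten here. What is kept of a nonzero incidence is that its square is
    -- 1, as both of its factors are powers of -1.
    incidence-cases : ∀ σ {F} → Face K F →
      (∃[ v ] v ∈ F × F ∖ v ≡ σ × incidence o σ F * incidence o σ F ≡ 1ℤ) ⊎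
      ((∀ v → v ∈ F → F ∖ v ≢ σ) × incidence o σ F ≡ 0ℤ)
    incidence-cases σ {F} F∈K with Fin.any? (λ i → F ∖ lookup (order F) i ≟ˢ σ)
    ... | yes (i , F∖v≡σ) = inj₁
      ( lookup (order F) i
      , Equivalence.to (enumerate F∈K _) (Membership.∈-lookup i)
      , F∖v≡σ
      , trans (rearrange (-1ℤ ℤ.^ toℕ i) (sgn (removeAt (order F) i) (order σ)))
              (cong₂ _*_ (neg1^-square (toℕ i))
                         (neg1^-square (inversions (map (λ x → position x (order σ))
                                                        (removeAt (order F) i)))))
      )
      where
      rearrange : ∀ x y → (x * y) * (x * y) ≡ (x * x) * (y * y)
      rearrange = solve-∀
    ... | no none = inj₂ ((λ v v∈F F∖v≡σ → none (v∈order v v∈F F∖v≡σ)) , refl)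
      where
      v∈order : ∀ v → v ∈ F → F ∖ v ≡ σ → ∃[ i ] F ∖ lookup (order F) i ≡ σ
      v∈order v v∈F eq = Any.index v∈ , subst (λ v → F ∖ v ≡ σ) (Any.lookup-index v∈) eq
        where v∈ = Equivalence.from (enumerate F∈K v) v∈F

    incidence² : ∀ σ {F} → Face K F → incidence o σ F * incidence o σ F ≡ covers σ F
    incidence² σ F∈K with incidence-cases σ F∈K
    ... | inj₁ (v , v∈F , F∖v≡σ , sq) = trans sq (sym (covers-once v∈F F∖v≡σ))
    ... | inj₂ (none , inc≡0)         =
      trans (cong₂ _*_ inc≡0 inc≡0) (sym (covers-none none))

    gram : ℕ → Subset n → Subset n → ℤ
    gram k F G = ∑ (facesOfSize K k) λ σ → incidence o σ F * incidence o σ G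

    gram-diagonal : ∀ {k F} → FaceOfDim K k F → gram k F F ≡ pos (suc k)
    gram-diagonal {k} F∈K =
      trans (∑-cong (facesOfSize K k) λ σ → incidence² σ (proj₁ F∈K)) (covers-size F∈K)

    -- If all four incidences were nonzero, σ and σ′ would be two distinct faces covered by both F
    -- and G, and `cover-unique` would identify F with G.
    incidence-orthogonal : ∀ {F G σ σ′} → Face K F → Face K G → F ≢ G → σ ≢ σ′ →
      (incidence o σ F * incidence o σ G) * (incidence o σ′ F * incidence o σ′ G) ≡ 0ℤ
    incidence-orthogonal {F} {G} {σ} {σ′} F∈K G∈K F≢G σ≢σ′
      with incidence-cases σ F∈K | incidence-cases σ G∈K | incidence-cases σ′ F∈K | incidence-cases σ′ G∈K
    ... | inj₁ (_ , _ , Fv , _) | inj₁ (_ , _ , Gw , _) | inj₁ (_ , _ , Fv′ , _) | inj₁ (_ , _ , Gw′ , _) =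
      contradiction (cover-unique Fv Fv′ Gw Gw′ σ≢σ′) F≢G
    ... | inj₂ (_ , eq) | _ | _ | _ rewrite eq = refl
    ... | inj₁ _ | inj₂ (_ , eq) | _ | _ rewrite eq | ℤ.*-zeroʳ (incidence o σ F) = refl
    ... | inj₁ _ | inj₁ _ | inj₂ (_ , eq) | _ rewrite eq = ℤ.*-zeroʳ (incidence o σ F * incidence o σ G)
    ... | inj₁ _ | inj₁ _ | inj₁ _ | inj₂ (_ , eq)
      rewrite eq | ℤ.*-zeroʳ (incidence o σ′ F) = ℤ.*-zeroʳ (incidence o σ F * incidence o σ G)

    gram-off-diagonal : ∀ {k F G} → Face K F → Face K G → F ≢ G →
      gram k F G * gram k F G ≡ ∑ (facesOfSize K k) λ σ → covers σ F * covers σ G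
    gram-off-diagonal {k} {F} {G} F∈K G∈K F≢G = begin
      gram k F G * gram k F G
        ≡⟨ ∑-*-∑ Y Y p p ⟩
      ∑ Y (λ σ → ∑ Y λ σ′ → p σ * p σ′)
        -- The mixed terms vanish, so the square of the sum is the sum of the squares, in which no
        -- sign remains.
        ≡⟨ ∑-cong Y (λ σ → ∑-cong Y λ σ′ → diagonal σ σ′) ⟩
      ∑ Y (λ σ → ∑ Y λ σ′ → 𝟙 (σ′ ≟ˢ σ) * (p σ * p σ′))
        ≡⟨ ∑-cong Y (λ σ → ∑-faces-≟ k σ (λ σ′ → p σ * p σ′)) ⟩
      ∑ Y (λ σ → 𝟙 (faceOfSize? K k σ) * (p σ * p σ))
        ≡⟨ ∑-faces-cong k (λ σ σ∈K → begin
             𝟙 (faceOfSize? K k σ) * (p σ * p σ)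
               ≡⟨ cong (_* (p σ * p σ)) (𝟙-yes (faceOfSize? K k σ) σ∈K) ⟩
             1ℤ * (p σ * p σ)
               ≡⟨ rearrange (incidence o σ F) (incidence o σ G) ⟩
             (incidence o σ F * incidence o σ F) * (incidence o σ G * incidence o σ G)
               ≡⟨ cong₂ _*_ (incidence² σ F∈K) (incidence² σ G∈K) ⟩
             covers σ F * covers σ G ∎) ⟩
      ∑ Y (λ σ → covers σ F * covers σ G) ∎
      where
      Y = facesOfSize K k

      p : Subset n → ℤ
      p σ = incidence o σ F * incidence o σ G

      rearrange : ∀ x y → 1ℤ * ((x * y) * (x * y)) ≡ (x * x) * (y * y)
      rearrange = solve-∀

      diagonal : ∀ σ σ′ → p σ * p σ′ ≡ 𝟙 (σ′ ≟ˢ σ) * (p σ * p σ′)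
      diagonal σ σ′ with σ′ ≟ˢ σ
      ... | yes _   = sym (ℤ.*-identityˡ _)
      ... | no σ′≢σ = incidence-orthogonal F∈K G∈K F≢G (σ′≢σ ∘ sym)

  -- Both traces are the same fourfold sum over s, t, x, y. Grouping the entries by row index
  -- instead of by column index makes the sums over s and t independent, and each equals the inner
  -- product of columns x and y.
  trace-gram : ∀ {a b} {A : Set a} {B : Set b} (xs : List A) (ys : List B) (m : A → B → ℤ) →
    ∑ xs (λ s → ∑ xs λ t → ∑ ys (λ x → m s x * m t x) * ∑ ys (λ y → m t y * m s y)) ≡
    ∑ ys (λ x → ∑ ys λ y → ∑ xs (λ s → m s x * m s y) * ∑ xs (λ s → m s x * m s y))
  trace-gram xs ys m = begin
    ∑ xs (λ s → ∑ xs λ t → ∑ ys (λ x → m s x * m t x) * ∑ ys (λ y → m t y * m s y))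
      ≡⟨ ∑-cong xs (λ s → ∑-cong xs λ t → ∑-*-∑ ys ys (λ x → m s x * m t x) (λ y → m t y * m s y)) ⟩
    ∑ xs (λ s → ∑ xs λ t → ∑ ys λ x → ∑ ys λ y → h s t x y)
      ≡⟨ ∑-cong xs (λ s → ∑-comm xs ys (λ t x → ∑ ys λ y → h s t x y)) ⟩
    ∑ xs (λ s → ∑ ys λ x → ∑ xs λ t → ∑ ys λ y → h s t x y)
      ≡⟨ ∑-comm xs ys (λ s x → ∑ xs λ t → ∑ ys λ y → h s t x y) ⟩
    ∑ ys (λ x → ∑ xs λ s → ∑ xs λ t → ∑ ys λ y → h s t x y)
      ≡⟨ ∑-cong ys (λ x → ∑-cong xs λ s → ∑-comm xs ys (λ t y → h s t x y)) ⟩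
    ∑ ys (λ x → ∑ xs λ s → ∑ ys λ y → ∑ xs λ t → h s t x y)
      ≡⟨ ∑-cong ys (λ x → ∑-comm xs ys (λ s y → ∑ xs λ t → h s t x y)) ⟩
    ∑ ys (λ x → ∑ ys λ y → ∑ xs λ s → ∑ xs λ t → h s t x y)
      ≡⟨ ∑-cong ys (λ x → ∑-cong ys λ y → begin
           ∑ xs (λ s → ∑ xs λ t → h s t x y)
             ≡⟨ ∑-cong xs (λ s → ∑-cong xs λ t → rearrange (m s x) (m t x) (m t y) (m s y)) ⟩
           ∑ xs (λ s → ∑ xs λ t → (m s x * m s y) * (m t x * m t y))
             ≡⟨ ∑-*-∑ xs xs (λ s → m s x * m s y) (λ s → m s x * m s y) ⟨
           ∑ xs (λ s → m s x * m s y) * ∑ xs (λ s → m s x * m s y) ∎) ⟩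
    ∑ ys (λ x → ∑ ys λ y → ∑ xs (λ s → m s x * m s y) * ∑ xs (λ s → m s x * m s y)) ∎
    where
    h : _ → _ → _ → _ → ℤ
    h s t x y = (m s x * m t x) * (m t y * m s y)

    rearrange : ∀ a b c d → (a * b) * (c * d) ≡ (a * d) * (b * c)
    rearrange = solve-∀

  -- Trichotomy splits the unit weight of (i, j) into three indicators. By symmetry of `w`, the part
  -- with j < i is the part with i < j after exchanging the order of summation.
  ∑-symmetric : ∀ {n} (w : Fin n → Fin n → ℤ) → (∀ i j → w i j ≡ w j i) →
    let pairs = filter (λ (i , j) → i Fin.<? j) (cartesianProduct (allFin n) (allFin n)) in
    ∑ (allFin n) (λ i → ∑ (allFin n) (w i)) ≡
    ∑ (allFin n) (λ i → w i i) + pos 2 * ∑ pairs (λ (i , j) → w i j)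
  ∑-symmetric {n} w w-sym = begin
    ∑ V (λ i → ∑ V (w i))
      ≡⟨ ∑-cong V (λ i → trans (∑-cong V (split i)) (trans
           (∑-+ V (λ j → 𝟙 (j Fin.≟ i) * w i j) (λ j → below i j + below j i))
           (cong₂ _+_ (∑-allFin-≟ i (w i)) (∑-+ V (below i) (λ j → below j i))))) ⟩
    ∑ V (λ i → w i i + (∑ V (below i) + ∑ V (λ j → below j i)))
      ≡⟨ ∑-+ V (λ i → w i i) _ ⟩
    ∑ V (λ i → w i i) + ∑ V (λ i → ∑ V (below i) + ∑ V (λ j → below j i))
      ≡⟨ cong (∑ V (λ i → w i i) +_) (begin
           ∑ V (λ i → ∑ V (below i) + ∑ V (λ j → below j i))
             ≡⟨ ∑-+ V (λ i → ∑ V (below i)) (λ i → ∑ V (λ j → below j i)) ⟩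
           half + ∑ V (λ i → ∑ V (λ j → below j i))
             ≡⟨ cong (half +_) (∑-comm V V (λ i j → below j i)) ⟩
           half + half
             ≡⟨ double half ⟩
           pos 2 * half
             ≡⟨ cong (pos 2 *_) (sym (trans
                  (∑-filter (λ (i , j) → i Fin.<? j) (cartesianProduct V V) (λ (i , j) → w i j))
                  (∑-cartesianProduct V V (λ (i , j) → below i j)))) ⟩
           pos 2 * ∑ pairs′ (λ (i , j) → w i j) ∎) ⟩
    ∑ V (λ i → w i i) + pos 2 * ∑ pairs′ (λ (i , j) → w i j) ∎
    where
    V      = allFin n
    pairs′ = filter (λ (i , j) → i Fin.<? j) (cartesianProduct V V)

    below : Fin n → Fin n → ℤ
    below i j = 𝟙 (i Fin.<? j) * w i j

    half = ∑ V λ i → ∑ V (below i)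

    double : ∀ x → x + x ≡ pos 2 * x
    double = solve-∀

    expand : ∀ x y z u → x + (y + z) ≡ 1ℤ → u ≡ x * u + (y * u + z * u)
    expand x y z u eq = begin
      u                         ≡⟨ ℤ.*-identityˡ u ⟨
      1ℤ * u                    ≡⟨ cong (_* u) eq ⟨
      (x + (y + z)) * u         ≡⟨ distribute x y z u ⟩
      x * u + (y * u + z * u)   ∎
      where
      distribute : ∀ x y z u → (x + (y + z)) * u ≡ x * u + (y * u + z * u)
      distribute = solve-∀

    trichotomy : ∀ i j → 𝟙 (j Fin.≟ i) + (𝟙 (i Fin.<? j) + 𝟙 (j Fin.<? i)) ≡ 1ℤ
    trichotomy i j with Fin.<-cmp i j
    ... | tri< i<j i≢j j≮i
      rewrite 𝟙-no (j Fin.≟ i) (i≢j ∘ sym) | 𝟙-yes (i Fin.<? j) i<j | 𝟙-no (j Fin.<? i) j≮i = refl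
    ... | tri≈ i≮j i≡j j≮i
      rewrite 𝟙-yes (j Fin.≟ i) (sym i≡j) | 𝟙-no (i Fin.<? j) i≮j | 𝟙-no (j Fin.<? i) j≮i = refl
    ... | tri> i≮j i≢j j<i
      rewrite 𝟙-no (j Fin.≟ i) (i≢j ∘ sym) | 𝟙-no (i Fin.<? j) i≮j | 𝟙-yes (j Fin.<? i) j<i = refl

    split : ∀ i j → w i j ≡ 𝟙 (j Fin.≟ i) * w i j + (below i j + below j i)
    split i j = trans
      (expand (𝟙 (j Fin.≟ i)) (𝟙 (i Fin.<? j)) (𝟙 (j Fin.<? i)) (w i j) (trichotomy i j))
      (cong (λ u → 𝟙 (j Fin.≟ i) * w i j + (below i j + 𝟙 (j Fin.<? i) * u)) (w-sym i j))

  -- A number is the count of its positive levels. As `upTo` starts at 0, the index r stands for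
  -- level r + 1, and d ≤ m ensures that no level is cut off.
  ∑-upTo-≤ : ∀ m d → d ≤ m → ∑ (upTo m) (λ r → 𝟙 (suc r ℕ.≤? d)) ≡ pos d
  ∑-upTo-≤ m zero d≤m = trans
    (∑-cong (upTo m) λ r → 𝟙-no (suc r ℕ.≤? 0) λ ())
    (∑-0 (upTo m))
  ∑-upTo-≤ (suc m) (suc d) (s≤s d≤m) = begin
    1ℤ + ∑ (applyUpTo suc m) (λ r → 𝟙 (suc r ℕ.≤? suc d))
      ≡⟨ cong (λ rs → 1ℤ + ∑ rs (λ r → 𝟙 (suc r ℕ.≤? suc d))) (List.map-applyUpTo id suc m) ⟨
    1ℤ + ∑ (map suc (upTo m)) (λ r → 𝟙 (suc r ℕ.≤? suc d))
      ≡⟨ cong (1ℤ +_) (∑-map suc (upTo m) (λ r → 𝟙 (suc r ℕ.≤? suc d))) ⟩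
    1ℤ + ∑ (upTo m) (λ r → 𝟙 (suc (suc r) ℕ.≤? suc d))
      ≡⟨ cong (1ℤ +_) (∑-cong (upTo m) λ r →
           𝟙-cong (suc (suc r) ℕ.≤? suc d) (suc r ℕ.≤? d) ℕ.s≤s⁻¹ s≤s) ⟩
    1ℤ + ∑ (upTo m) (λ r → 𝟙 (suc r ℕ.≤? d))
      ≡⟨ cong (1ℤ +_) (∑-upTo-≤ m d d≤m) ⟩
    pos (suc d) ∎

  -- Counting shifts, codegrees and degrees

  module Counting {n} (K : SimplicialComplex n) (k : ℕ) where
    open Complex K

    V = allFin n
    X = facesOfDim K k
    Y = facesOfSize K k

    successful-sum : ∀ i j → pos (successfulShifts K k i j) ≡ ∑ X λ F → 𝟙 (successful? K k i j F)
    successful-sum i j = length-filter (successful? K k i j) X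

    deg-sum : ∀ i → pos (deg K k i) ≡ ∑ X λ F → 𝟙 (i ∈? F)
    deg-sum i = length-filter (i ∈?_) X

    -- The exchange of j for i is undone by the exchange of i for j. Bundling the equation with
    -- admissibility makes the statement its own converse, so it serves both directions in
    -- `successful-sym`.
    shift-inverse : ∀ {i j F G} → G ≡ shift K k i j F × Admissible K k i j F →
                    F ≡ shift K k j i G × Admissible K k j i G
    shift-inverse {i} {j} {F} (refl , j∈F , i∉F) =
      sym (trans (cong (_∪ ⁅ j ⁆) (p∪x-x i∉F∖j)) (p-x∪x j∈F)) , x∈p∪x (F ∖ j) i , j∉
      where
      i∉F∖j : i ∉ F ∖ j
      i∉F∖j = i∉F ∘ x∈p-y⇒x∈p j

      j∉ : j ∉ shift K k i j F
      j∉ j∈ with Subset.x∈p∪q⁻ (F ∖ j) ⁅ i ⁆ j∈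
      ... | inj₁ j∈F∖j = x∉p-x F j j∈F∖j
      ... | inj₂ j∈i with refl ← Subset.x∈⁅y⁆⇒x≡y i j∈i = i∉F j∈F

    -- Successful shifts become ordered pairs of facets (F, G) with G the shift of F; in this form,
    -- swapping F and G exhibits the symmetry in i and j.
    successful-pairs : ∀ i j → pos (successfulShifts K k i j) ≡
      ∑ X λ F → ∑ X λ G → 𝟙 (G ≟ˢ shift K k i j F) * 𝟙 (admissible? K k i j F)
    successful-pairs i j = trans (successful-sum i j) (∑-cong X λ F → begin
      𝟙 (successful? K k i j F)
        ≡⟨ 𝟙-× (admissible? K k i j F) (faceOfDim? K k (shift K k i j F)) ⟩
      𝟙 (admissible? K k i j F) * 𝟙 (faceOfDim? K k (shift K k i j F))
        ≡⟨ ℤ.*-comm (𝟙 (admissible? K k i j F)) _ ⟩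
      𝟙 (faceOfDim? K k (shift K k i j F)) * 𝟙 (admissible? K k i j F)
        ≡⟨ ∑-faces-≟ (suc k) (shift K k i j F) (λ _ → 𝟙 (admissible? K k i j F)) ⟨
      ∑ X (λ G → 𝟙 (G ≟ˢ shift K k i j F) * 𝟙 (admissible? K k i j F)) ∎)

    successful-sym : ∀ i j → pos (successfulShifts K k i j) ≡ pos (successfulShifts K k j i)
    successful-sym i j = begin
      pos (successfulShifts K k i j)
        ≡⟨ successful-pairs i j ⟩
      ∑ X (λ F → ∑ X λ G → step i j F G)
        ≡⟨ ∑-comm X X (step i j) ⟩
      ∑ X (λ G → ∑ X λ F → step i j F G)
        ≡⟨ ∑-cong X (λ G → ∑-cong X λ F → reverse F G) ⟩
      ∑ X (λ G → ∑ X λ F → step j i G F)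
        ≡⟨ successful-pairs j i ⟨
      pos (successfulShifts K k j i) ∎
      where
      step : Fin n → Fin n → Subset n → Subset n → ℤ
      step i j F G = 𝟙 (G ≟ˢ shift K k i j F) * 𝟙 (admissible? K k i j F)

      reverse : ∀ F G → step i j F G ≡ step j i G F
      reverse F G = begin
        step i j F G
          ≡⟨ 𝟙-× (G ≟ˢ shift K k i j F) (admissible? K k i j F) ⟨
        𝟙 (G ≟ˢ shift K k i j F ×-dec admissible? K k i j F)
          ≡⟨ 𝟙-cong (G ≟ˢ shift K k i j F ×-dec admissible? K k i j F)
                    (F ≟ˢ shift K k j i G ×-dec admissible? K k j i G) shift-inverse shift-inverse ⟩
        𝟙 (F ≟ˢ shift K k j i G ×-dec admissible? K k j i G)
          ≡⟨ 𝟙-× (F ≟ˢ shift K k j i G) (admissible? K k j i G) ⟩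
        step j i G F ∎

    successful-diagonal : ∀ i → pos (successfulShifts K k i i) ≡ 0ℤ
    successful-diagonal i = begin
      pos (successfulShifts K k i i)
        ≡⟨ successful-sum i i ⟩
      ∑ X (λ F → 𝟙 (successful? K k i i F))
        ≡⟨ ∑-cong X (λ F → 𝟙-no (successful? K k i i F) λ ((i∈F , i∉F) , _) → i∉F i∈F) ⟩
      ∑ X (λ _ → 0ℤ)
        ≡⟨ ∑-0 X ⟩
      0ℤ ∎

    -- A pair (σ, G) with σ covered by F and by G ≠ F is a walk that first deletes some j from F and
    -- then adds some i, that is, a successful shift of F.
    neighbour-sum : ∀ {F} → FaceOfDim K k F →
      ∑ X (λ G → 𝟙 (¬? (G ≟ˢ F)) * ∑ Y λ σ → covers σ F * covers σ G) ≡
      ∑ V λ j → ∑ V λ i → 𝟙 (successful? K k i j F)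
    neighbour-sum {F} F∈K = begin
      ∑ X (λ G → 𝟙 (¬? (G ≟ˢ F)) * ∑ Y λ σ → covers σ F * covers σ G)
        ≡⟨ ∑-cong X (λ G → trans (sym (∑-*ˡ Y (𝟙 (¬? (G ≟ˢ F))) (λ σ → covers σ F * covers σ G)))
             (∑-cong Y λ σ → rearrange (𝟙 (¬? (G ≟ˢ F))) (covers σ F) (covers σ G))) ⟩
      ∑ X (λ G → ∑ Y λ σ → covers σ F * (covers σ G * 𝟙 (¬? (G ≟ˢ F))))
        ≡⟨ ∑-comm X Y (λ G σ → covers σ F * (covers σ G * 𝟙 (¬? (G ≟ˢ F)))) ⟩
      ∑ Y (λ σ → ∑ X λ G → covers σ F * (covers σ G * 𝟙 (¬? (G ≟ˢ F))))
        ≡⟨ ∑-cong Y (λ σ → trans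
             (∑-*ˡ X (covers σ F) (λ G → covers σ G * 𝟙 (¬? (G ≟ˢ F))))
             (cong (covers σ F *_) (∑-coboundary (suc k) σ (λ G → 𝟙 (¬? (G ≟ˢ F)))))) ⟩
      ∑ Y (λ σ → covers σ F * ψ σ)
        ≡⟨ ∑-boundary F∈K ψ ⟩
      ∑ V (λ j → 𝟙 (j ∈? F) * ψ (F ∖ j))
        ≡⟨ ∑-cong V (λ j → trans
             (sym (∑-*ˡ V (𝟙 (j ∈? F)) (λ i → χ i (F ∖ j))))
             (∑-cong V λ i → shifted i j)) ⟩
      ∑ V (λ j → ∑ V λ i → 𝟙 (successful? K k i j F)) ∎
      where
      χ : Fin n → Subset n → ℤ
      χ i σ = 𝟙 (¬? (i ∈? σ)) * (𝟙 (faceOfDim? K k (σ ∪ ⁅ i ⁆)) * 𝟙 (¬? ((σ ∪ ⁅ i ⁆) ≟ˢ F)))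

      ψ : Subset n → ℤ
      ψ σ = ∑ V λ i → χ i σ

      rearrange : ∀ a b c → a * (b * c) ≡ b * (c * a)
      rearrange = solve-∀

      -- Avoiding F without j still allows i = j. That walk returns to F, which is what the
      -- condition G ≠ F excludes.
      i∉F : ∀ {i j} → j ∈ F → i ∉ F ∖ j → shift K k i j F ≢ F → i ∉ F
      i∉F {i} {j} j∈F i∉F∖j moved i∈F with i Fin.≟ j
      ... | yes refl = moved (p-x∪x j∈F)
      ... | no i≢j   = i∉F∖j (Subset.x∈p∧x≢y⇒x∈p-y i∈F i≢j)

      shifted : ∀ i j → 𝟙 (j ∈? F) * χ i (F ∖ j) ≡ 𝟙 (successful? K k i j F)
      shifted i j = begin
        𝟙 j∈F? * (𝟙 i∉? * (𝟙 face * 𝟙 moved?))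
          ≡⟨ cong (λ u → 𝟙 j∈F? * (𝟙 i∉? * u)) (𝟙-× face moved?) ⟨
        𝟙 j∈F? * (𝟙 i∉? * 𝟙 (face ×-dec moved?))
          ≡⟨ cong (𝟙 j∈F? *_) (𝟙-× i∉? (face ×-dec moved?)) ⟨
        𝟙 j∈F? * 𝟙 (i∉? ×-dec (face ×-dec moved?))
          ≡⟨ 𝟙-× j∈F? (i∉? ×-dec (face ×-dec moved?)) ⟨
        𝟙 (j∈F? ×-dec (i∉? ×-dec (face ×-dec moved?)))
          ≡⟨ 𝟙-cong (j∈F? ×-dec (i∉? ×-dec (face ×-dec moved?))) (successful? K k i j F)
               (λ (j∈F , i∉F∖j , f , moved) → (j∈F , i∉F j∈F i∉F∖j moved) , f)
               (λ ((j∈F , i∉F) , f) →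
                 j∈F , i∉F ∘ x∈p-y⇒x∈p j , f , λ eq → i∉F (subst (i ∈_) eq (x∈p∪x (F ∖ j) i))) ⟩
        𝟙 (successful? K k i j F) ∎
        where
        j∈F?   = j ∈? F
        i∉?    = ¬? (i ∈? (F ∖ j))
        face   = faceOfDim? K k (shift K k i j F)
        moved? = ¬? (shift K k i j F ≟ˢ F)

    c² : ℤ
    c² = pos (suc k) * pos (suc k)

    codegree : Fin n → Fin n → ℤ
    codegree i j = ∑ X λ F → 𝟙 (i ∈? F) * 𝟙 (j ∈? F)

    codegree-diagonal : ∀ i → codegree i i ≡ pos (deg K k i)
    codegree-diagonal i = trans (∑-cong X λ F → idempotent (i ∈? F)) (sym (deg-sum i))
      where
      idempotent : ∀ {p} {P : Set p} (P? : Dec P) → 𝟙 P? * 𝟙 P? ≡ 𝟙 P?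
      idempotent (yes _) = refl
      idempotent (no _)  = refl

    -- Each facet contains (k + 1)² ordered pairs of vertices, equal ones included.
    codegree-total : ∑ V (λ i → ∑ V (codegree i)) ≡ ∑ X (λ _ → c²)
    codegree-total = begin
      ∑ V (λ i → ∑ V λ j → ∑ X λ F → 𝟙 (i ∈? F) * 𝟙 (j ∈? F))
        ≡⟨ ∑-cong V (λ i → ∑-comm V X (λ j F → 𝟙 (i ∈? F) * 𝟙 (j ∈? F))) ⟩
      ∑ V (λ i → ∑ X λ F → ∑ V λ j → 𝟙 (i ∈? F) * 𝟙 (j ∈? F))
        ≡⟨ ∑-comm V X (λ i F → ∑ V λ j → 𝟙 (i ∈? F) * 𝟙 (j ∈? F)) ⟩
      ∑ X (λ F → ∑ V λ i → ∑ V λ j → 𝟙 (i ∈? F) * 𝟙 (j ∈? F))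
        ≡⟨ ∑-faces-cong (suc k) (λ F (_ , ∣F∣) → begin
             ∑ V (λ i → ∑ V λ j → 𝟙 (i ∈? F) * 𝟙 (j ∈? F))
               ≡⟨ ∑-*-∑ V V (λ i → 𝟙 (i ∈? F)) (λ j → 𝟙 (j ∈? F)) ⟨
             ∑ V (λ i → 𝟙 (i ∈? F)) * ∑ V (λ j → 𝟙 (j ∈? F))
               ≡⟨ cong₂ _*_ (size F ∣F∣) (size F ∣F∣) ⟩
             c² ∎) ⟩
      ∑ X (λ _ → c²) ∎
      where
      size : ∀ F → ∣ F ∣ ≡ suc k → ∑ V (λ i → 𝟙 (i ∈? F)) ≡ pos (suc k)
      size F ∣F∣ = trans (∑-membership F) (cong pos ∣F∣)

    admissible-codegree : ∀ i j → pos (admissibleShifts K k i j) ≡ pos (deg K k j) - codegree i j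
    admissible-codegree i j = begin
      pos (admissibleShifts K k i j)
        ≡⟨ length-filter (admissible? K k i j) X ⟩
      ∑ X (λ F → 𝟙 (admissible? K k i j F))
        ≡⟨ ∑-cong X (λ F → begin
             𝟙 (admissible? K k i j F)
               ≡⟨ 𝟙-× (j ∈? F) (¬? (i ∈? F)) ⟩
             𝟙 (j ∈? F) * 𝟙 (¬? (i ∈? F))
               ≡⟨ cong (𝟙 (j ∈? F) *_) (𝟙-¬ (i ∈? F)) ⟩
             𝟙 (j ∈? F) * (1ℤ - 𝟙 (i ∈? F))
               ≡⟨ rearrange (𝟙 (j ∈? F)) (𝟙 (i ∈? F)) ⟩
             𝟙 (j ∈? F) + -1ℤ * (𝟙 (i ∈? F) * 𝟙 (j ∈? F)) ∎) ⟩
      ∑ X (λ F → 𝟙 (j ∈? F) + -1ℤ * (𝟙 (i ∈? F) * 𝟙 (j ∈? F)))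
        ≡⟨ ∑-+ X (λ F → 𝟙 (j ∈? F)) (λ F → -1ℤ * (𝟙 (i ∈? F) * 𝟙 (j ∈? F))) ⟩
      ∑ X (λ F → 𝟙 (j ∈? F)) + ∑ X (λ F → -1ℤ * (𝟙 (i ∈? F) * 𝟙 (j ∈? F)))
        ≡⟨ cong₂ _+_ (sym (deg-sum j)) (∑-*ˡ X -1ℤ (λ F → 𝟙 (i ∈? F) * 𝟙 (j ∈? F))) ⟩
      pos (deg K k j) + -1ℤ * codegree i j
        ≡⟨ cong (pos (deg K k j) +_) (ℤ.-1*i≡-i (codegree i j)) ⟩
      pos (deg K k j) - codegree i j ∎
      where
      rearrange : ∀ x y → x * (1ℤ - y) ≡ x + -1ℤ * (y * x)
      rearrange = solve-∀

    -- The minimum of the two degrees, counted by levels: this is the form in which it comes out of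
    -- the squares of the conjugate degrees.
    minDeg : Fin n → Fin n → ℤ
    minDeg i j = ∑ (upTo (length X)) λ r → 𝟙 (suc r ℕ.≤? deg K k i) * 𝟙 (suc r ℕ.≤? deg K k j)

    minDeg-sym : ∀ i j → minDeg i j ≡ minDeg j i
    minDeg-sym i j = ∑-cong (upTo (length X)) λ r →
      ℤ.*-comm (𝟙 (suc r ℕ.≤? deg K k i)) (𝟙 (suc r ℕ.≤? deg K k j))

    minDeg-≥ : ∀ i j → deg K k j ≤ deg K k i → minDeg i j ≡ pos (deg K k j)
    minDeg-≥ i j dj≤di = trans
      (∑-cong (upTo (length X)) λ r → trans
        (sym (𝟙-× (suc r ℕ.≤? deg K k i) (suc r ℕ.≤? deg K k j)))
        (𝟙-cong (suc r ℕ.≤? deg K k i ×-dec suc r ℕ.≤? deg K k j) (suc r ℕ.≤? deg K k j)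
          proj₂ (λ r<dj → ℕ.≤-trans r<dj dj≤di , r<dj)))
      -- The cut-off at the number of facets loses nothing, since no degree exceeds it.
      (∑-upTo-≤ (length X) (deg K k j) (List.length-filter (j ∈?_) X))

    -- The square at level r counts ordered pairs of vertices whose degrees are both at least r;
    -- summing over levels first gives the minimum.
    conjugate-sum : pos (sumOfSquaredConjugateDegrees K k) ≡ ∑ V (λ i → ∑ V (minDeg i))
    conjugate-sum = begin
      pos (sumOfSquaredConjugateDegrees K k)
        ≡⟨ embed U ⟩
      ∑ U (λ r → pos (conjugateDegree K k (suc r)) * pos (conjugateDegree K k (suc r)))
        ≡⟨ ∑-cong U (λ r → trans (cong₂ _*_ (count r) (count r)) (∑-*-∑ V V (a r) (a r))) ⟩
      ∑ U (λ r → ∑ V λ i → ∑ V λ j → a r i * a r j)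
        ≡⟨ ∑-comm U V (λ r i → ∑ V λ j → a r i * a r j) ⟩
      ∑ V (λ i → ∑ U λ r → ∑ V λ j → a r i * a r j)
        ≡⟨ ∑-cong V (λ i → ∑-comm U V (λ r j → a r i * a r j)) ⟩
      ∑ V (λ i → ∑ V (minDeg i)) ∎
      where
      U = upTo (length X)

      a : ℕ → Fin n → ℤ
      a r i = 𝟙 (suc r ℕ.≤? deg K k i)

      count : ∀ r → pos (conjugateDegree K k (suc r)) ≡ ∑ V (a r)
      count r = length-filter (λ i → suc r ℕ.≤? deg K k i) V

      embed : ∀ rs → pos (foldr (λ r s → conjugateDegree K k (suc r) ℕ.^ 2 ℕ.+ s) 0 rs) ≡
                     ∑ rs (λ r → pos (conjugateDegree K k (suc r)) * pos (conjugateDegree K k (suc r)))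
      embed []       = refl
      embed (r ∷ rs) = cong₂ _+_
        (trans (cong (λ m → pos (d ℕ.* m)) (ℕ.*-identityʳ d)) (ℤ.pos-* d d))
        (embed rs)
        where d = conjugateDegree K k (suc r)

    P = pairs K k

    -- `Successful` includes admissibility, so for every facet the indicator of failure is that of
    -- an admissible shift minus that of a successful one.
    failed-sum : pos (numberOfFailedShifts K k) ≡ sumOfShiftDefects K k
    failed-sum = begin
      pos (numberOfFailedShifts K k)
        ≡⟨ length-filter (failedShift? K k) (cartesianProduct V (cartesianProduct V S)) ⟩
      ∑ (cartesianProduct V (cartesianProduct V S)) (λ t → 𝟙 (failedShift? K k t))
        ≡⟨ ∑-cartesianProduct V (cartesianProduct V S) (λ t → 𝟙 (failedShift? K k t)) ⟩
      ∑ V (λ i → ∑ (cartesianProduct V S) λ t → 𝟙 (failedShift? K k (i , t)))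
        ≡⟨ ∑-cong V (λ i → ∑-cartesianProduct V S (λ t → 𝟙 (failedShift? K k (i , t)))) ⟩
      ∑ V (λ i → ∑ V λ j → ∑ S λ σ → 𝟙 (failedShift? K k (i , j , σ)))
        ≡⟨ ∑-cong V (λ i → ∑-cong V λ j → row i j) ⟩
      ∑ V (λ i → ∑ V λ j → 𝟙 (i Fin.<? j) * defect i j)
        ≡⟨ ∑-cartesianProduct V V (λ (i , j) → 𝟙 (i Fin.<? j) * defect i j) ⟨
      ∑ (cartesianProduct V V) (λ (i , j) → 𝟙 (i Fin.<? j) * defect i j)
        ≡⟨ ∑-filter (λ (i , j) → i Fin.<? j) (cartesianProduct V V) (λ (i , j) → defect i j) ⟨
      sumOfShiftDefects K k ∎
      where
      S = allSubsets n

      defect : Fin n → Fin n → ℤ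
      defect i j = pos (admissibleShifts K k i j) - pos (successfulShifts K k i j)

      rearrange : ∀ a b → a * (1ℤ - b) ≡ a + -1ℤ * (a * b)
      rearrange = solve-∀

      row : ∀ i j → ∑ S (λ σ → 𝟙 (failedShift? K k (i , j , σ))) ≡ 𝟙 (i Fin.<? j) * defect i j
      row i j = begin
        ∑ S (λ σ → 𝟙 (failedShift? K k (i , j , σ)))
          ≡⟨ ∑-cong S (λ σ → trans (𝟙-× (i Fin.<? j) (fd σ ×-dec (ad σ ×-dec ¬? (sh σ))))
               (cong (𝟙 (i Fin.<? j) *_) (𝟙-× (fd σ) (ad σ ×-dec ¬? (sh σ))))) ⟩
        ∑ S (λ σ → 𝟙 (i Fin.<? j) * (𝟙 (fd σ) * 𝟙 (ad σ ×-dec ¬? (sh σ))))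
          ≡⟨ ∑-*ˡ S (𝟙 (i Fin.<? j)) (λ σ → 𝟙 (fd σ) * 𝟙 (ad σ ×-dec ¬? (sh σ))) ⟩
        𝟙 (i Fin.<? j) * ∑ S (λ σ → 𝟙 (fd σ) * 𝟙 (ad σ ×-dec ¬? (sh σ)))
          ≡⟨ cong (𝟙 (i Fin.<? j) *_) (begin
               ∑ S (λ σ → 𝟙 (fd σ) * 𝟙 (ad σ ×-dec ¬? (sh σ)))
                 ≡⟨ ∑-filter fd S (λ σ → 𝟙 (ad σ ×-dec ¬? (sh σ))) ⟨
               ∑ X (λ σ → 𝟙 (ad σ ×-dec ¬? (sh σ)))
                 ≡⟨ ∑-cong X (λ σ → begin
                      𝟙 (ad σ ×-dec ¬? (sh σ))         ≡⟨ 𝟙-× (ad σ) (¬? (sh σ)) ⟩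
                      𝟙 (ad σ) * 𝟙 (¬? (sh σ))         ≡⟨ cong (𝟙 (ad σ) *_) (𝟙-¬ (sh σ)) ⟩
                      𝟙 (ad σ) * (1ℤ - 𝟙 (sh σ))       ≡⟨ rearrange (𝟙 (ad σ)) (𝟙 (sh σ)) ⟩
                      𝟙 (ad σ) + -1ℤ * (𝟙 (ad σ) * 𝟙 (sh σ))
                        ≡⟨ cong (λ u → 𝟙 (ad σ) + -1ℤ * u) (𝟙-× (ad σ) (sh σ)) ⟨
                      𝟙 (ad σ) + -1ℤ * 𝟙 (successful? K k i j σ) ∎) ⟩
               ∑ X (λ σ → 𝟙 (ad σ) + -1ℤ * 𝟙 (successful? K k i j σ))
                 ≡⟨ ∑-+ X (λ σ → 𝟙 (ad σ)) (λ σ → -1ℤ * 𝟙 (successful? K k i j σ)) ⟩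
               ∑ X (λ σ → 𝟙 (ad σ)) + ∑ X (λ σ → -1ℤ * 𝟙 (successful? K k i j σ))
                 ≡⟨ cong₂ _+_ (sym (length-filter ad X))
                      (trans (∑-*ˡ X -1ℤ (λ σ → 𝟙 (successful? K k i j σ)))
                             (cong (-1ℤ *_) (sym (successful-sum i j)))) ⟩
               pos (admissibleShifts K k i j) + -1ℤ * pos (successfulShifts K k i j)
                 ≡⟨ cong (pos (admissibleShifts K k i j) +_) (ℤ.-1*i≡-i (pos (successfulShifts K k i j))) ⟩
               defect i j ∎) ⟩
        𝟙 (i Fin.<? j) * defect i j ∎
        where
        fd = faceOfDim? K k
        ad = admissible? K k i j
        sh = λ σ → faceOfDim? K k (shift K k i j σ)

    R : Fin n → Fin n → ℤ
    R i j = pos (successfulShifts K k i j)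

    -- The trace of the squared up-Laplacian and the moment gap

    module _ (o : Orientation K) where
      open Gram o

      gram² : ∀ {F G} → FaceOfDim K k F → FaceOfDim K k G →
        gram k F G * gram k F G ≡
        𝟙 (G ≟ˢ F) * c² + 𝟙 (¬? (G ≟ˢ F)) * ∑ Y (λ σ → covers σ F * covers σ G)
      gram² {F} {G} F∈K G∈K with G ≟ˢ F
      ... | yes refl = trans (cong₂ _*_ (gram-diagonal F∈K) (gram-diagonal F∈K))
                             (sym (trans (ℤ.+-identityʳ _) (ℤ.*-identityˡ c²)))
      ... | no G≢F   = trans (gram-off-diagonal (proj₁ F∈K) (proj₁ G∈K) (G≢F ∘ sym))
                             (sym (trans (ℤ.+-identityˡ _) (ℤ.*-identityˡ _)))

      upLaplacian-sum : ∀ a b → upLaplacian o k a b ≡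
        ∑ X λ F → incidence o (lookup Y a) F * incidence o (lookup Y b) F
      upLaplacian-sum a b = ℤsum-lookup X (λ F → incidence o (lookup Y a) F * incidence o (lookup Y b) F)

      trace-upLaplacian² :
        ℤsum (λ a → ℤsum λ b → upLaplacian o k a b * upLaplacian o k b a) ≡
        ∑ X (λ _ → c²) + ∑ V (λ i → ∑ V (R i))
      trace-upLaplacian² = begin
        ℤsum (λ a → ℤsum λ b → upLaplacian o k a b * upLaplacian o k b a)
          ≡⟨ ℤsum-cong (length Y) (λ a → trans
               (ℤsum-cong (length Y) λ b → cong₂ _*_ (upLaplacian-sum a b) (upLaplacian-sum b a))
               (ℤsum-lookup Y (λ τ → L (lookup Y a) τ * L τ (lookup Y a)))) ⟩
        ℤsum (λ a → ∑ Y λ τ → L (lookup Y a) τ * L τ (lookup Y a))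
          ≡⟨ ℤsum-lookup Y (λ σ → ∑ Y λ τ → L σ τ * L τ σ) ⟩
        ∑ Y (λ σ → ∑ Y λ τ → L σ τ * L τ σ)
          ≡⟨ trace-gram Y X (incidence o) ⟩
        ∑ X (λ F → ∑ X λ G → gram k F G * gram k F G)
          ≡⟨ ∑-faces-cong (suc k) row ⟩
        ∑ X (λ F → c² + ∑ V λ j → ∑ V λ i → 𝟙 (successful? K k i j F))
          ≡⟨ ∑-+ X (λ _ → c²) (λ F → ∑ V λ j → ∑ V λ i → 𝟙 (successful? K k i j F)) ⟩
        ∑ X (λ _ → c²) + ∑ X (λ F → ∑ V λ j → ∑ V λ i → 𝟙 (successful? K k i j F))
          ≡⟨ cong (∑ X (λ _ → c²) +_) (begin
               ∑ X (λ F → ∑ V λ j → ∑ V λ i → 𝟙 (successful? K k i j F))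
                 ≡⟨ ∑-comm X V (λ F j → ∑ V λ i → 𝟙 (successful? K k i j F)) ⟩
               ∑ V (λ j → ∑ X λ F → ∑ V λ i → 𝟙 (successful? K k i j F))
                 ≡⟨ ∑-cong V (λ j → trans (∑-comm X V (λ F i → 𝟙 (successful? K k i j F)))
                      (∑-cong V λ i → sym (successful-sum i j))) ⟩
               ∑ V (λ j → ∑ V λ i → R i j)
                 ≡⟨ ∑-comm V V (λ j i → R i j) ⟩
               ∑ V (λ i → ∑ V (R i)) ∎) ⟩
        ∑ X (λ _ → c²) + ∑ V (λ i → ∑ V (R i)) ∎
        where
        L : Subset n → Subset n → ℤ
        L σ τ = ∑ X λ F → incidence o σ F * incidence o τ F

        row : ∀ F → FaceOfDim K k F → ∑ X (λ G → gram k F G * gram k F G) ≡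
                                      c² + ∑ V (λ j → ∑ V λ i → 𝟙 (successful? K k i j F))
        row F F∈K = begin
          ∑ X (λ G → gram k F G * gram k F G)
            ≡⟨ ∑-faces-cong (suc k) (λ G G∈K → gram² F∈K G∈K) ⟩
          ∑ X (λ G → 𝟙 (G ≟ˢ F) * c² + 𝟙 (¬? (G ≟ˢ F)) * ∑ Y (λ σ → covers σ F * covers σ G))
            ≡⟨ ∑-+ X (λ G → 𝟙 (G ≟ˢ F) * c²)
                     (λ G → 𝟙 (¬? (G ≟ˢ F)) * ∑ Y (λ σ → covers σ F * covers σ G)) ⟩
          ∑ X (λ G → 𝟙 (G ≟ˢ F) * c²) +
          ∑ X (λ G → 𝟙 (¬? (G ≟ˢ F)) * ∑ Y (λ σ → covers σ F * covers σ G))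
            ≡⟨ cong₂ _+_
                 (trans (∑-faces-≟ (suc k) F (λ _ → c²))
                        (trans (cong (_* c²) (𝟙-yes (faceOfDim? K k F) F∈K)) (ℤ.*-identityˡ c²)))
                 (neighbour-sum F∈K) ⟩
          c² + ∑ V (λ j → ∑ V λ i → 𝟙 (successful? K k i j F)) ∎

      moment-gap : (∀ (i j : Fin n) → i Fin.≤ j → deg K k j ≤ deg K k i) →
        pos (sumOfSquaredConjugateDegrees K k) -
        ℤsum (λ a → ℤsum λ b → upLaplacian o k a b * upLaplacian o k b a) ≡
        pos 2 * sumOfShiftDefects K k
      moment-gap deg-anti = begin
        pos (sumOfSquaredConjugateDegrees K k) -
        ℤsum (λ a → ℤsum λ b → upLaplacian o k a b * upLaplacian o k b a)
          -- `D` is the common diagonal of the minima and the codegrees and cancels. The `0ℤ` is the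
          -- diagonal of `R`: no facet both contains and omits i.
          ≡⟨ cong₂ _-_ conjugate trace ⟩
        (D + pos 2 * Δ) - ((D + pos 2 * C) + (0ℤ + pos 2 * S))
          ≡⟨ rearrange D Δ C S ⟩
        pos 2 * ((Δ + -1ℤ * C) + -1ℤ * S)
          ≡⟨ cong (pos 2 *_) defects ⟨
        pos 2 * sumOfShiftDefects K k ∎
        where
        D = ∑ V λ i → pos (deg K k i)
        Δ = ∑ P λ (i , j) → pos (deg K k j)
        C = ∑ P λ (i , j) → codegree i j
        S = ∑ P λ (i , j) → R i j

        rearrange : ∀ D Δ C S → (D + pos 2 * Δ) - ((D + pos 2 * C) + (0ℤ + pos 2 * S)) ≡
                                pos 2 * ((Δ + -1ℤ * C) + -1ℤ * S)
        rearrange = solve-∀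

        -- The labelling by decreasing degree enters here: for i < j the minimum of the two degrees
        -- is that of j.
        conjugate : pos (sumOfSquaredConjugateDegrees K k) ≡ D + pos 2 * Δ
        conjugate = trans conjugate-sum (trans (∑-symmetric minDeg minDeg-sym) (cong₂ (λ x y → x + pos 2 * y)
          (∑-cong V λ i → minDeg-≥ i i ℕ.≤-refl)
          (∑-filter-cong (λ (i , j) → i Fin.<? j) (cartesianProduct V V)
            λ (i , j) i<j → minDeg-≥ i j (deg-anti i j (ℕ.<⇒≤ i<j)))))

        trace : ℤsum (λ a → ℤsum λ b → upLaplacian o k a b * upLaplacian o k b a) ≡
                (D + pos 2 * C) + (0ℤ + pos 2 * S)
        trace = trans trace-upLaplacian² (cong₂ _+_
          (trans (sym codegree-total) (trans
            (∑-symmetric codegree λ i j → ∑-cong X λ F → ℤ.*-comm (𝟙 (i ∈? F)) (𝟙 (j ∈? F)))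
            (cong (_+ pos 2 * C) (∑-cong V codegree-diagonal))))
          (trans (∑-symmetric R successful-sym)
            (cong (_+ pos 2 * S) (trans (∑-cong V successful-diagonal) (∑-0 V)))))

        defects : sumOfShiftDefects K k ≡ (Δ + -1ℤ * C) + -1ℤ * S
        defects = begin
          ∑ P (λ (i , j) → pos (admissibleShifts K k i j) - R i j)
            ≡⟨ ∑-cong P (λ (i , j) → trans (cong (_- R i j) (admissible-codegree i j))
                 (negate (pos (deg K k j)) (codegree i j) (R i j))) ⟩
          ∑ P (λ (i , j) → (pos (deg K k j) + -1ℤ * codegree i j) + -1ℤ * R i j)
            ≡⟨ ∑-+ P (λ (i , j) → pos (deg K k j) + -1ℤ * codegree i j) (λ (i , j) → -1ℤ * R i j) ⟩
          ∑ P (λ (i , j) → pos (deg K k j) + -1ℤ * codegree i j) + ∑ P (λ (i , j) → -1ℤ * R i j)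
            ≡⟨ cong₂ _+_ (trans (∑-+ P (λ (i , j) → pos (deg K k j)) (λ (i , j) → -1ℤ * codegree i j))
                                (cong (Δ +_) (∑-*ˡ P -1ℤ (λ (i , j) → codegree i j))))
                         (∑-*ˡ P -1ℤ (λ (i , j) → R i j)) ⟩
          (Δ + -1ℤ * C) + -1ℤ * S ∎
          where
          negate : ∀ d c r → (d - c) - r ≡ (d + -1ℤ * c) + -1ℤ * r
          negate = solve-∀

-- Transfer of the integer identity to the reals

open import Data.Integer.Base as ℤ using (+_)

theorem3p9 : ∀ {c ℓ₁ ℓ₂ ℓ₃} (ℝ : RealNumbers c ℓ₁ ℓ₂ ℓ₃) →
    let open RealNumbers ℝ in
    ∀ (n k : ℕ) (K : SimplicialComplex n) →
    1 ≤ k →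
    PureOfDim K k →
    (∀ (i j : Fin n) → i Fin.≤ j → deg K k j ≤ deg K k i) →
    ∀ (o : Orientation K) (λs : List Carrier) →
    IsNonzeroSpectrum ℝ (upLaplacian o k) λs →
    let gap = fromℕ (sumOfSquaredConjugateDegrees K k) - sumOfSquares ℝ λs in
    (gap ≈ fromℤ (+ 2 ℤ.* sumOfShiftDefects K k)) ×
    (gap ≈ fromℕ (2 ℕ.* numberOfFailedShifts K k))
theorem3p9 ℝ n k K _ _ deg-anti o λs spectrum =
  gap≈defects , trans gap≈defects (reflexive (≡.cong fromℤ failures))
  where
  open RealNumbers ℝ
  open Spectrum ℝ using (sumOfSquares≈trace; fromℤ-neg; fromℤ-+)
  open Moments.Counting K k using (moment-gap; failed-sum)

  A = sumOfSquaredConjugateDegrees K k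
  T = ℤsum λ a → ℤsum λ b → upLaplacian o k a b ℤ.* upLaplacian o k b a

  -- Since `fromℕ A` is `fromℤ (+ A)` by definition, the subtraction can be pulled back to `ℤ`,
  -- where `moment-gap` applies.
  gap≈defects : fromℕ A - sumOfSquares ℝ λs ≈ fromℤ (+ 2 ℤ.* sumOfShiftDefects K k)
  gap≈defects =
    trans (+-congˡ (trans (-‿cong (sumOfSquares≈trace (upLaplacian o k) λs spectrum))
                          (sym (fromℤ-neg T))))
      (trans (sym (fromℤ-+ (+ A) (ℤ.- T))) (reflexive (≡.cong fromℤ (moment-gap o deg-anti))))

  failures : + 2 ℤ.* sumOfShiftDefects K k ≡ + (2 ℕ.* numberOfFailedShifts K k)
  failures = ≡.trans (≡.cong (+ 2 ℤ.*_) (≡.sym failed-sum)) (≡.sym (ℤ.pos-* 2 (numberOfFailedShifts K k)))
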